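{- Let $\mathbf H$ be a finite connected ordered hypergraph that is right-filled. Then for any two constructs $S,T$ of $\mathbf H$, one has $S\leq T$ in the generalised flip order if and only if $$\mathrm{Inv}_{\mathbf H}(S)\subseteq\mathrm{Inv}_{\mathbf H}(T)\quad\text{and}\quad \widetilde{\mathrm{Inv}}_{\mathbf H}(S)\subseteq\widetilde{\mathrm{Inv}}_{\mathbf H}(T)\cup\mathrm{Inv}_{\mathbf H}(T).$$
   Context: A (finite) hypergraph $\mathbf H$ with finite vertex set $H$ is a set of non-empty subsets of $H$ (hyperedges) with $\bigcup\mathbf H=H$ and $\{x\}\in\mathbf H$ for all $x\in H$. For $X\subseteq H$, $\mathbf H_X:=\{Z\in\mathbf H: Z\subseteq X\}$ and $\mathbf H\setminus X:=\mathbf H_{H\setminus X}$. $\mathbf H$ is connected if there is no partition $H=X_1\cup X_2$ into two non-empty parts with $\mathbf H=\mathbf H_{X_1}\cup\mathbf H_{X_2}$. Every hypergraph is uniquely the union of its connected components; $\mathbf H,X\leadsto H_1,\dots,H_n$ means that $\mathbf H_{H_1},\dots,\mathbf H_{H_n}$ are the connected components of $\mathbf H\setminus X$. Constructs of a connected hypergraph $\mathbf H$ are non-planar rooted trees with nodes labelled by non-empty subsets of $H$, defined recursively: the one-node tree labelled $H$ is a construct of $\mathbf H$; if $\emptyset\neq Y\subsetneq H$, $\mathbf H,Y\leadsto H_1,\dots,H_n$, and $T_i$ is a construct of $\mathbf H_{H_i}$ for each $i$, then the tree $Y(T_1,\dots,T_n)$ with root $Y$ and immediate subtrees $T_1,\dots,T_n$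 is a construct of $\mathbf H$. Nodes are identified with their labels (the labels partition $H$). $\mathbf H$ is ordered if $H$ carries a total order; for non-empty $Y,Z\subseteq H$, $Y<Z$ (or $Z>Y$) means $\max Y<\min Z$. An ordered $\mathbf H$ is right-filled if for all $a,b,c\in H$ with $a<b<c$ and every hyperedge $X\in\mathbf H$ with $a,c\in X$, there is a hyperedge $Y\in\mathbf H$ with $\{b,c\}\subseteq Y\subseteq(X\setminus\{a\})\cup\{b\}$. If in a construct $S$ the node $X$ is the parent of the node $Y$, contracting the edge between them and labelling the merged node $X\cup Y$ yields a construct $T$; write $S\subset_{X,Y}T$. For constructs $S,S'$ of $\mathbf H$, $S\lessdot S'$ iff there exist $U,V$ with $U>V$ such that either $S\subset_{U,V}S'$ (fusion) or $S'\subset_{V,U}S$ (split). The generalised flip order $\leq$ is the reflexive and transitive closure of $\lessdot$. For a construct $S$ of $\mathbf H$ and $a,b\in H$ lying in the nodes $A,B$ of $S$ respectively: $b<_Sa$ iff $A\neq B$ and the path from $B$ to the root of $S$ passes through $A$ (i.e. $A$ is a proper ancestor of $B$); $a=_Sb$ iff $A=B$. Set $\mathrm{Inv}_{\mathbf H}(S)=\{(a,b)\in H\times H: a<b,\ b<_Sa\}$ and $\widetilde{\mathrm{Inv}}_{\mathbf H}(S)=\{(a,b)\in H\times H: a<b,\ a=_Sb\}$. -}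

module Defs where

open import Data.Fin.Base using (Fin)
open import Data.Fin.Subset as Sub
  using (Subset; Nonempty; Empty; ⁅_⁆; ⊤; ⋃; _∩_; _─_; _-_)
open import Data.List.Base using (List; []; _∷_; _++_)
open import Data.List.Relation.Binary.Permutation.Homogeneous using (Permutation)
open import Data.List.Relation.Binary.Pointwise.Base using (Pointwise)
open import Data.List.Relation.Unary.All using (All)
open import Data.List.Relation.Unary.AllPairs using (AllPairs)
open import Data.List.Relation.Unary.Any using (Any)
open import Data.Nat.Base using (ℕ)
open import Data.Product.Base using (∃-syntax; Σ-syntax; _×_; _,_; proj₁)
open import Data.Sum.Base using (_⊎_)
open import Level using (0ℓ)
open import Relation.Binary.Construct.Closure.ReflexiveTransitive using (Star)
import Relation.Binary.Construct.NonStrictToStrict as NonStrictToStrict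
open import Relation.Binary.Core using (Rel)
open import Relation.Binary.PropositionalEquality.Core using (_≡_)
open import Relation.Binary.Structures using (IsTotalOrder)
open import Relation.Nullary.Negation.Core using (¬_)
open import Relation.Unary using (Pred; Decidable; _≐_; _∪_)

private
  variable
    n : ℕ

-- The vertex set is Fin n.  The singleton edges already force the union of
-- all hyperedges to be the whole vertex set.  Decidability makes the
-- hyperedges a (finite) set of subsets in the classical sense.
record Hypergraph (n : ℕ) : Set₁ where
  field
    Edge      : Pred (Subset n) 0ℓ
    edge?     : Decidable Edge
    nonempty  : ∀ {Z} → Edge Z → Nonempty Z
    singleton : ∀ x → Edge ⁅ x ⁆

open Hypergraph public

-- The hyperedges of 𝐇_X.  A hypergraph of the form 𝐇_X is always represented
-- below by the pair of 𝐇 and its vertex set X; this loses nothing, since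
-- (𝐇_X)_Y = 𝐇_Y for Y ⊆ X.
infix 8 _↾_
_↾_ : Hypergraph n → Subset n → Pred (Subset n) 0ℓ
(𝐇 ↾ X) Z = Edge 𝐇 Z × Z Sub.⊆ X

-- 𝐇_X is connected.
Connected : Hypergraph n → Subset n → Set
Connected 𝐇 X =
  ¬ (∃[ X₁ ] ∃[ X₂ ] Nonempty X₁ × Nonempty X₂
       × Empty (X₁ ∩ X₂) × (X₁ Sub.∪ X₂ ≡ X)
       × (𝐇 ↾ X ≐ 𝐇 ↾ X₁ ∪ 𝐇 ↾ X₂))

-- 𝐇_K, for K in Ks, are the connected components of 𝐇_X, listed in some
-- order: the decomposition of 𝐇_X as a disjoint union of non-empty connected
-- hypergraphs.
record Components (𝐇 : Hypergraph n) (X : Subset n) (Ks : List (Subset n)) : Set where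
  field
    nonempties : All Nonempty Ks
    disjoint   : AllPairs (λ K L → Empty (K ∩ L)) Ks
    vertices   : ⋃ Ks ≡ X
    edges      : 𝐇 ↾ X ≐ (λ Z → Any (λ K → (𝐇 ↾ K) Z) Ks)
    connected  : All (Connected 𝐇) Ks

-- 𝐇_X , Y ⤳ Ks, where 𝐇_X ∖ Y = 𝐇_{X ∖ Y}.
infix 4 _↾_,_⤳_
_↾_,_⤳_ : Hypergraph n → Subset n → Subset n → List (Subset n) → Set
𝐇 ↾ X , Y ⤳ Ks = Components 𝐇 (X ─ Y) Ks

data Tree (n : ℕ) : Set where
  node : Subset n → List (Tree n) → Tree n

-- Equality of non-planar trees: children are compared up to reordering, at
-- every level.
infix 4 _≈_
data _≈_ {n : ℕ} : Rel (Tree n) 0ℓ where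
  node : ∀ {X ts us} → Permutation _≈_ ts us → node X ts ≈ node X us

-- IsConstruct 𝐇 X T: the tree T is a construct of 𝐇_X.
data IsConstruct {n : ℕ} (𝐇 : Hypergraph n) : Subset n → Tree n → Set where
  one   : ∀ {X} → Nonempty X → IsConstruct 𝐇 X (node X [])
  graft : ∀ {X Y Ks ts} → Nonempty Y → Y Sub.⊂ X → 𝐇 ↾ X , Y ⤳ Ks →
          Pointwise (IsConstruct 𝐇) Ks ts → IsConstruct 𝐇 X (node Y ts)

Construct : Hypergraph n → Set
Construct {n} 𝐇 = Σ[ T ∈ Tree n ] IsConstruct 𝐇 ⊤ T

-- S ⊂[ X , Y ] T: contracting an edge of S from a node X to its child Y gives
-- T.  Trees being non-planar, the children on the way to that edge can be
-- reordered so that the edge is always in the leftmost subtree.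
infix 4 _⊂[_,_]_
data _⊂[_,_]_ {n : ℕ} (S : Tree n) (X Y : Subset n) (T : Tree n) : Set where
  here  : ∀ {ts us} →
          S ≈ node X (node Y us ∷ ts) → T ≈ node (X Sub.∪ Y) (us ++ ts) →
          S ⊂[ X , Y ] T
  there : ∀ {Z S′ T′ ts} →
          S ≈ node Z (S′ ∷ ts) → T ≈ node Z (T′ ∷ ts) → S′ ⊂[ X , Y ] T′ →
          S ⊂[ X , Y ] T

infix 4 _∈ᴺ_
data _∈ᴺ_ {n : ℕ} (A : Subset n) : Tree n → Set where
  here  : ∀ {ts} → A ∈ᴺ node A ts
  there : ∀ {X ts} → Any (A ∈ᴺ_) ts → A ∈ᴺ node X ts

-- In the given tree, A is a proper ancestor of B.
data Ancestor {n : ℕ} (A B : Subset n) : Tree n → Set where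
  here  : ∀ {ts} → Any (B ∈ᴺ_) ts → Ancestor A B (node A ts)
  there : ∀ {X ts} → Any (Ancestor A B) ts → Ancestor A B (node X ts)

_<[_]_ : Fin n → Tree n → Fin n → Set
b <[ S ] a = ∃[ A ] ∃[ B ] a Sub.∈ A × b Sub.∈ B × Ancestor A B S

_=[_]_ : Fin n → Tree n → Fin n → Set
a =[ S ] b = ∃[ A ] A ∈ᴺ S × a Sub.∈ A × b Sub.∈ A

record OrderedHypergraph (n : ℕ) : Set₁ where
  field
    hypergraph   : Hypergraph n
    _≤_          : Rel (Fin n) 0ℓ
    isTotalOrder : IsTotalOrder _≡_ _≤_

  open NonStrictToStrict _≡_ _≤_ public using (_<_)

  IsMax IsMin : Fin n → Subset n → Set
  IsMax m Y = m Sub.∈ Y × (∀ y → y Sub.∈ Y → y ≤ m)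
  IsMin m Z = m Sub.∈ Z × (∀ z → z Sub.∈ Z → m ≤ z)

  _<ˢ_ : Rel (Subset n) 0ℓ
  Y <ˢ Z = ∃[ m ] ∃[ k ] IsMax m Y × IsMin k Z × m < k

  RightFilled : Set
  RightFilled = ∀ a b c → a < b → b < c →
    ∀ X → Edge hypergraph X → a Sub.∈ X → c Sub.∈ X →
    ∃[ Y ] Edge hypergraph Y
      × (⁅ b ⁆ Sub.∪ ⁅ c ⁆ Sub.⊆ Y) × (Y Sub.⊆ (X - a) Sub.∪ ⁅ b ⁆)

  Inv Inv~ : Construct hypergraph → Pred (Fin n × Fin n) 0ℓ
  Inv  (S , _) (a , b) = a < b × b <[ S ] a
  Inv~ (S , _) (a , b) = a < b × a =[ S ] b

  infix 4 _⋖_ _≤ᶠ_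
  _⋖_ : Rel (Construct hypergraph) 0ℓ
  (S , _) ⋖ (S′ , _) =
    ∃[ U ] ∃[ V ] V <ˢ U × (S ⊂[ U , V ] S′ ⊎ S′ ⊂[ V , U ] S)

  -- The generalised flip order.  Star is reflexive for _≡_ only; the left
  -- summand makes it reflexive for equality of non-planar trees.
  _≤ᶠ_ : Rel (Construct hypergraph) 0ℓ
  _≤ᶠ_ = Star (λ S T → proj₁ S ≈ proj₁ T ⊎ S ⋖ T)

{-# OPTIONS --safe #-}

-- A fusion or a split only moves pairs a < b in one direction, from neither,
-- through a = b in the same node, to inverted. For a split of U ∪ V into V
-- over U this uses right-filledness: vertices larger than all of V that are
-- connected in a set X remain connected in X ∖ V, so all larger vertices below
-- V lie in the child rooted at U.
--
-- Conversely, let B be the root of T. The assumption on S says that no x ∉ B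
-- with x < b ∈ B is an ancestor of b or in the node of b, and that no x ∈ B
-- with x < b is an ancestor of b. Pulling B recursively to the roots of the
-- children of S, fusing these pieces into the root A of S and splitting A ∪ B
-- into B over A ∖ B gives S ≤ S′ with S′ rooted at B, where all new relations
-- involve B. The components of 𝐇 ∖ A are comparable as sets, again by
-- right-filledness, and fusing in decreasing order keeps every piece
-- smaller than the current root. Then S′ and T have the same components below
-- B, and one recurses on T.
module Submission where

open import Defs
open import Data.Empty using (⊥-elim)
open import Data.Fin.Base using (Fin)
open import Data.Fin.Properties as Fin using (any?)
open import Data.Fin.Subset using (⊤)
open import Data.Fin.Subset as Sub
  using (Subset; Nonempty; ⁅_⁆; ⋃; ∁; _∩_; _─_; _-_)
  renaming (_∈_ to _∈ˢ_; _∉_ to _∉ˢ_; _⊆_ to _⊆ˢ_)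
open import Data.Fin.Subset.Properties
open import Data.List.Base using (List; []; _∷_; _++_; map; foldl; filter; allFin)
open import Data.List.Membership.Propositional using (_∈_; _∉_; find; lose)
open import Data.List.Membership.Propositional.Properties
  using (∈-map⁺; ∈-map⁻; ∈-++⁺ˡ; ∈-++⁺ʳ; ∈-++⁻; ∈-filter⁺; ∈-filter⁻; ∈-allFin)
open import Data.List.Membership.Propositional.Properties.WithK using (unique∧set⇒bag)
open import Data.List.Properties using (map-++; ∷-injective)
open import Data.List.Relation.Binary.BagAndSetEquality using (∼bag⇒↭)
open import Data.List.Relation.Binary.Permutation.Homogeneous as Permutation using (Permutation)
open import Data.List.Relation.Binary.Permutation.Propositional as ↭ using (_↭_; ↭⇒↭ₛ)
import Data.List.Relation.Binary.Permutation.Propositional.Properties as ↭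
import Data.List.Relation.Binary.Permutation.Setoid.Properties as PermutationSetoid
open import Data.List.Relation.Binary.Pointwise.Base using (Pointwise; []; _∷_)
open import Data.List.Relation.Unary.All as All using (All; []; _∷_)
import Data.List.Relation.Unary.All.Properties as All
open import Data.List.Relation.Unary.AllPairs as AllPairs using (AllPairs; []; _∷_)
import Data.List.Relation.Unary.AllPairs.Properties as AllPairs
open import Data.List.Relation.Unary.Any as Any using (Any; here; there)
import Data.List.Relation.Unary.Any.Properties as Any
open import Data.List.Relation.Unary.Linked.Properties using (Linked⇒AllPairs)
import Data.List.Sort as Sort
open import Data.Nat.Base using (ℕ)
open import Data.Product.Base using (Σ-syntax; ∃-syntax; _×_; _,_; proj₁; proj₂)
open import Data.Sum.Base as Sum using (_⊎_; inj₁; inj₂; [_,_]′)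
open import Data.Vec.Base using (tabulate; _∷_; _[_]=_)
open import Data.Vec.Properties using (lookup∘tabulate; lookup⇒[]=; []=⇒lookup)
open import Function.Base using (_∘_; flip)
open import Function.Bundles using (_⇔_; mk⇔)
open import Level using (0ℓ)
open import Relation.Binary.Bundles using (TotalOrder; DecTotalOrder)
open import Relation.Binary.Construct.Closure.ReflexiveTransitive as Star using (Star; ε; _◅_; _◅◅_)
import Relation.Binary.Construct.Flip.EqAndOrd as Flip
import Relation.Binary.Construct.NonStrictToStrict as NonStrictToStrict
import Relation.Binary.Construct.On as On
open import Relation.Binary.Core using (Rel)
open import Relation.Binary.Definitions using (tri<; tri≈; tri>)
open import Relation.Binary.PropositionalEquality
  using (_≡_; _≢_; refl; sym; trans; cong; subst; setoid; resp₂)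
open import Relation.Binary.Structures using (IsTotalOrder; IsStrictTotalOrder)
open import Relation.Nullary
  using (¬_; Dec; yes; no; does; contradiction; _×-dec_; _⊎-dec_; ¬?)
open import Relation.Nullary.Decidable using (dec-true)
open import Relation.Unary using (Pred; Decidable; _⊆_; _∪_)

private
  variable
    n : ℕ
    I : Set
    S T : Tree n
    ts us : List (Tree n)
    A B X Y : Subset n
    x y : Fin n

-- Subsets cut out by decidable predicates.

module _ {P : Pred (Fin n) 0ℓ} (P? : Decidable P) where

  comprehension : Subset n
  comprehension = tabulate (does ∘ P?)

  ∈-comprehension⁺ : ∀ {x} → P x → x ∈ˢ comprehension
  ∈-comprehension⁺ {x} px =
    lookup⇒[]= x _ (trans (lookup∘tabulate (does ∘ P?) x) (dec-true (P? x) px))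

  ∈-comprehension⁻ : ∀ {x} → x ∈ˢ comprehension → P x
  ∈-comprehension⁻ {x} x∈ with P? x | trans (sym (lookup∘tabulate (does ∘ P?) x)) ([]=⇒lookup x∈)
  ... | yes px | _ = px

x∈p─q⁻ : ∀ {x} (p q : Subset n) → x ∈ˢ p ─ q → x ∈ˢ p × x ∉ˢ q
x∈p─q⁻ p q x∈ = p─q⊆p p q x∈ , λ x∈q → disjoint p q x∈ x∈q
  where
  disjoint : ∀ {n} {x : Fin n} (p q : Subset n) → x ∈ˢ p ─ q → x ∉ˢ q
  disjoint (_ ∷ p) (Sub.outside ∷ q) _[_]=_.here       ()
  disjoint (_ ∷ p) (_ ∷ q)           (_[_]=_.there x∈) (_[_]=_.there x∈q) = disjoint p q x∈ x∈q

-- Connectedness in terms of edge-closed sets.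

module Linkage (𝐇 : Hypergraph n) where

  -- Up to vertices outside `X`, such a `D` is a union of connected components of 𝐇_X.
  Closed : Subset n → Subset n → Set
  Closed X D = ∀ {E} → Edge 𝐇 E → E ⊆ˢ X → ∀ {x y} → x ∈ˢ E → y ∈ˢ E → x ∈ˢ D → y ∈ˢ D

  -- x and y are joined by a path of 𝐇_X; stated through edge-closed sets, so
  -- that no path has to be constructed from the negative notion of Connected.
  Linked : Subset n → Fin n → Fin n → Set
  Linked X x y = ∀ D → Closed X D → x ∈ˢ D → y ∈ˢ D

  Conn : Subset n → Set
  Conn X = ∀ {x y} → x ∈ˢ X → y ∈ˢ X → Linked X x y

  Linked-trans : ∀ {X x y z} → Linked X x y → Linked X y z → Linked X x z
  Linked-trans xy yz D cl = yz D cl ∘ xy D cl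

  -- The complement of a closed set is closed, so a closed set that contains `y` but not `x` would
  -- have a complement violating the linkage from `x` to `y`.
  Linked-sym : ∀ {X x y} → Linked X x y → Linked X y x
  Linked-sym {x = x} xy D cl y∈D with x ∈? D
  ... | yes x∈D = x∈D
  ... | no  x∉D = contradiction y∈D (x∈∁p⇒x∉p (xy (∁ D) cl′ (x∉p⇒x∈∁p x∉D)))
    where
    cl′ : Closed _ (∁ D)
    cl′ e E⊆X u∈E v∈E u∈∁D = x∉p⇒x∈∁p λ v∈D → x∈∁p⇒x∉p u∈∁D (cl e E⊆X v∈E u∈E v∈D)

  Linked-mono : ∀ {X Y x y} → X ⊆ˢ Y → Linked X x y → Linked Y x y
  Linked-mono X⊆Y xy D cl = xy D λ e E⊆X → cl e (X⊆Y ∘ E⊆X)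

  Linked-edge : ∀ {X E x y} → Edge 𝐇 E → E ⊆ˢ X → x ∈ˢ E → y ∈ˢ E → Linked X x y
  Linked-edge e E⊆X x∈E y∈E D cl = cl e E⊆X x∈E y∈E

  -- A test set `D` for 𝐇_L yields the test set `L ∩ D` for 𝐇_X, because an edge of 𝐇_X that meets
  -- the closed set `L` lies inside it.
  Linked-restrict : ∀ {X L x y} → Closed X L → x ∈ˢ L → Linked X x y → Linked L x y
  Linked-restrict {X} {L} clL x∈L xy D clD x∈D = proj₂ (x∈p∩q⁻ L D (xy (L ∩ D) cl (x∈p∩q⁺ (x∈L , x∈D))))
    where
    cl : Closed X (L ∩ D)
    cl e E⊆X u∈E v∈E u∈ = let u∈L , u∈D = x∈p∩q⁻ L D u∈ in
      x∈p∩q⁺ (clL e E⊆X u∈E v∈E u∈L , clD e (λ w∈E → clL e E⊆X u∈E w∈E u∈L) u∈E v∈E u∈D)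

  -- A closed `D` separating `x` from `y` would partition `X` into `X ∩ D` and `X ─ D`. Membership
  -- in `D` is decidable, so refuting this separation is enough.
  Connected⇒Conn : ∀ {X} → Connected 𝐇 X → Conn X
  Connected⇒Conn {X} conn {x} {y} x∈X y∈X D cl x∈D with y ∈? D
  ... | yes y∈D = y∈D
  ... | no  y∉D = contradiction
    ( X ∩ D , X ─ D , (x , x∈p∩q⁺ (x∈X , x∈D)) , (y , x∈p∧x∉q⇒x∈p─q y∈X y∉D)
    , (λ (z , z∈) → let z∈₁ , z∈₂ = x∈p∩q⁻ (X ∩ D) _ z∈ in
         proj₂ (x∈p─q⁻ X D z∈₂) (proj₂ (x∈p∩q⁻ X D z∈₁)))
    , ⊆-antisym ∪⊆ ⊆∪
    , (λ {_} → side) , (λ {_} → back)) conn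
    where
    ∪⊆ : (X ∩ D) Sub.∪ (X ─ D) ⊆ˢ X
    ∪⊆ z∈ = [ p∩q⊆p X D , p─q⊆p X D ]′ (x∈p∪q⁻ _ _ z∈)
    ⊆∪ : X ⊆ˢ (X ∩ D) Sub.∪ (X ─ D)
    ⊆∪ {z} z∈X with z ∈? D
    ... | yes z∈D = x∈p∪q⁺ (inj₁ (x∈p∩q⁺ (z∈X , z∈D)))
    ... | no  z∉D = x∈p∪q⁺ (inj₂ (x∈p∧x∉q⇒x∈p─q z∈X z∉D))
    back : ∀ {E} → (𝐇 ↾ (X ∩ D)) E ⊎ (𝐇 ↾ (X ─ D)) E → (𝐇 ↾ X) E
    back (inj₁ (e , E⊆)) = e , λ v∈E → p∩q⊆p X D (E⊆ v∈E)
    back (inj₂ (e , E⊆)) = e , λ v∈E → p─q⊆p X D (E⊆ v∈E)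
    side : ∀ {E} → (𝐇 ↾ X) E → (𝐇 ↾ (X ∩ D)) E ⊎ (𝐇 ↾ (X ─ D)) E
    side (e , E⊆X) with nonempty 𝐇 e
    ... | u , u∈E with u ∈? D
    ...   | yes u∈D = inj₁ (e , λ v∈E → x∈p∩q⁺ (E⊆X v∈E , cl e E⊆X u∈E v∈E u∈D))
    ...   | no  u∉D = inj₂ (e , λ v∈E → x∈p∧x∉q⇒x∈p─q (E⊆X v∈E) λ v∈D → u∉D (cl e E⊆X v∈E u∈E v∈D))

  -- In a forbidden partition `X₁` is closed, so linkage would carry a vertex of `X₂` into `X₁`.
  Conn⇒Connected : ∀ {X} → Conn X → Connected 𝐇 X
  Conn⇒Connected {X} conn (X₁ , X₂ , (x , x∈X₁) , (y , y∈X₂) , disj , refl , edges , _) =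
    disj (y , x∈p∩q⁺ (conn (x∈p∪q⁺ (inj₁ x∈X₁)) (x∈p∪q⁺ (inj₂ y∈X₂)) X₁ cl x∈X₁ , y∈X₂))
    where
    cl : Closed X X₁
    cl e E⊆X u∈E v∈E u∈X₁ with edges (e , E⊆X)
    ... | inj₁ (_ , E⊆X₁) = E⊆X₁ v∈E
    ... | inj₂ (_ , E⊆X₂) = contradiction (_ , x∈p∩q⁺ (u∈X₁ , E⊆X₂ u∈E)) disj

-- The order on vertices and the consequences of right-filledness.

module Ordering (𝐎 : OrderedHypergraph n) where
  open OrderedHypergraph 𝐎 public
  open Linkage hypergraph public
  open IsTotalOrder isTotalOrder public
    using (antisym; total) renaming (refl to ≤-refl; trans to ≤-trans)

  ≤-totalOrder : TotalOrder 0ℓ 0ℓ 0ℓ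
  ≤-totalOrder = record { isTotalOrder = isTotalOrder }

  open IsStrictTotalOrder (NonStrictToStrict.<-isStrictTotalOrder₁ _≡_ _≤_ Fin._≟_ isTotalOrder) public
    using (compare; _<?_) renaming (trans to <-trans; irrefl to <-irrefl; asym to <-asym)

  <-≤-trans : ∀ {x y z} → x < y → y ≤ z → x < z
  <-≤-trans = NonStrictToStrict.<-≤-trans _≡_ _≤_ sym ≤-trans antisym (λ { refl z → z })

  ≤-<-trans : ∀ {x y z} → x ≤ y → y < z → x < z
  ≤-<-trans = NonStrictToStrict.≤-<-trans _≡_ _≤_ ≤-trans antisym (λ { refl z → z })

  ≮⇒≥ : ∀ {x y} → ¬ x < y → y ≤ x
  ≮⇒≥ = NonStrictToStrict.≮⇒≥ _≡_ _≤_ sym Fin._≟_ (λ { refl → ≤-refl }) total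

  -- Unlike `_<ˢ_` this names no extrema and is vacuous for empty sets; the two agree on non-empty
  -- sets.
  _≪_ : Subset n → Subset n → Set
  Y ≪ Z = ∀ {y z} → y ∈ˢ Y → z ∈ˢ Z → y < z

  <ˢ⇒≪ : ∀ {Y Z} → Y <ˢ Z → Y ≪ Z
  <ˢ⇒≪ (m , k , (_ , y≤m) , (_ , k≤z) , m<k) y∈Y z∈Z = <-≤-trans (≤-<-trans (y≤m _ y∈Y) m<k) (k≤z _ z∈Z)

  private
    module _ {Y : Subset n} where
      elements : List (Fin n)
      elements = filter (_∈? Y) (allFin n)
      elements⁺ : ∀ {y} → y ∈ˢ Y → y ∈ elements
      elements⁺ = ∈-filter⁺ (_∈? Y) (∈-allFin _)
      elements⊆ : All (_∈ˢ Y) elements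
      elements⊆ = All.tabulate (proj₂ ∘ ∈-filter⁻ (_∈? Y) {xs = allFin n})

  open import Data.List.Extrema ≤-totalOrder using (max; min; argmax-all; argmin-all; xs≤max; min≤xs)

  ≪⇒<ˢ : ∀ {Y Z} → Nonempty Y → Nonempty Z → Y ≪ Z → Y <ˢ Z
  ≪⇒<ˢ {Y} {Z} (y₀ , y₀∈Y) (z₀ , z₀∈Z) Y≪Z =
    _ , _ , (m∈ , λ y y∈Y → All.lookup (xs≤max y₀ elements) (elements⁺ y∈Y))
    , (k∈ , λ z z∈Z → All.lookup (min≤xs z₀ elements) (elements⁺ z∈Z)) , Y≪Z m∈ k∈
    where
    -- The default value `y₀` is itself taken from `Y`, so the maximum lies in `Y` in every case.
    m∈ : max y₀ elements ∈ˢ Y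
    m∈ = argmax-all (λ x → x) y₀∈Y elements⊆
    k∈ : min z₀ elements ∈ˢ Z
    k∈ = argmin-all (λ x → x) z₀∈Z elements⊆

  module _ (rf : RightFilled) where

    private
      fill : ∀ {a b c E} → a < b → b < c → Edge hypergraph E → a ∈ˢ E → c ∈ˢ E →
             ∃[ Y ] Edge hypergraph Y × b ∈ˢ Y × c ∈ˢ Y × (∀ {x} → x ∈ˢ Y → x ≢ a × (x ∈ˢ E ⊎ x ≡ b))
      fill {a} {b} {c} {E} a<b b<c e a∈E c∈E with rf a b c a<b b<c E e a∈E c∈E
      ... | Y , eY , bc⊆Y , Y⊆ =
        Y , eY , bc⊆Y (x∈p∪q⁺ (inj₁ (x∈⁅x⁆ b))) , bc⊆Y (x∈p∪q⁺ (inj₂ (x∈⁅x⁆ c)))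
        , λ x∈Y → [ (λ x∈ → let x∈E , x∉a = x∈p─q⁻ E ⁅ a ⁆ x∈ in (λ { refl → x∉a (x∈⁅x⁆ a) }) , inj₁ x∈E)
                  , (λ x∈ → case-b (x∈⁅y⁆⇒x≡y b x∈)) ]′ (x∈p∪q⁻ _ _ (Y⊆ x∈Y))
        where
        case-b : ∀ {x} → x ≡ b → x ≢ a × (x ∈ˢ E ⊎ x ≡ b)
        case-b refl = (λ { refl → <-irrefl refl a<b }) , inj₂ refl

      -- A test set `D` for linkage in `X - v` is turned into one for linkage in `X` that has the
      -- same vertices larger than `v`. This is how removing `v` is shown to preserve linkage above
      -- it.
      module Removal {X v a} (v<a : v < a) (D : Subset n) (clD : Closed (X - v) D) where

        -- Closing D in 𝐇_X: larger vertices must gain nothing, while all vertices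
        -- that are not larger than v are reached at once, provided that an edge
        -- joins v to a larger vertex of D.
        Gate : Pred (Fin n) 0ℓ
        Gate q = v < q × q ∈ˢ D × ∃[ E ] Edge hypergraph E × E ⊆ˢ X × q ∈ˢ E × v ∈ˢ E

        Reached : Pred (Fin n) 0ℓ
        Reached x = (v < x × x ∈ˢ D) ⊎ (¬ v < x × ∃[ q ] Gate q)

        reached? : Decidable Reached
        reached? x = ((v <? x) ×-dec (x ∈? D)) ⊎-dec
          ¬? (v <? x) ×-dec
          any? (λ q → (v <? q) ×-dec (q ∈? D) ×-dec
            anySubset? (λ E → edge? hypergraph E ×-dec (E ⊆? X) ×-dec (q ∈? E) ×-dec (v ∈? E)))

        ⊆-minus : ∀ {Y E b} → E ⊆ˢ X → b ∈ˢ E ⊎ b ∈ˢ X →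
                  (∀ {x} → x ∈ˢ Y → x ≢ v × (x ∈ˢ E ⊎ x ≡ b)) → Y ⊆ˢ X - v
        ⊆-minus E⊆X b∈ Y⊆ x∈Y with Y⊆ x∈Y
        ... | x≢v , inj₁ x∈E  = x∈p∧x≢y⇒x∈p-y (E⊆X x∈E) x≢v
        ... | x≢v , inj₂ refl = x∈p∧x≢y⇒x∈p-y ([ E⊆X , (λ z → z) ]′ b∈) x≢v

        -- Right-filledness for `v < x < y` replaces `v` by `x` in the edge; the new edge avoids
        -- `v`, so `D` has to respect it.
        join : ∀ {E x y} → Edge hypergraph E → E ⊆ˢ X → v ∈ˢ E → y ∈ˢ E → x ∈ˢ X →
               v < x → x < y → (x ∈ˢ D → y ∈ˢ D) × (y ∈ˢ D → x ∈ˢ D)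
        join e E⊆X v∈E y∈E x∈X v<x x<y with fill v<x x<y e v∈E y∈E
        ... | Y , eY , x∈Y , y∈Y , Y⊆ =
          clD eY Y⊆X-v x∈Y y∈Y , clD eY Y⊆X-v y∈Y x∈Y
          where Y⊆X-v = ⊆-minus E⊆X (inj₂ x∈X) Y⊆

        -- All vertices larger than `v` that share an edge of 𝐇_X with `v` are together inside or
        -- outside `D`: of two such vertices, `join` is applied to the edge containing the larger
        -- one.
        above : ∀ {E F x y} → Edge hypergraph E → E ⊆ˢ X → x ∈ˢ E → v ∈ˢ E →
                Edge hypergraph F → F ⊆ˢ X → y ∈ˢ F → v ∈ˢ F →
                v < x → v < y → x ∈ˢ D → y ∈ˢ D
        above {x = x} {y} e E⊆X x∈E v∈E f F⊆X y∈F v∈F v<x v<y x∈D with compare x y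
        ... | tri< x<y _ _  = proj₁ (join f F⊆X v∈F y∈F (E⊆X x∈E) v<x x<y) x∈D
        ... | tri≈ _ refl _ = x∈D
        ... | tri> _ _ y<x  = proj₂ (join e E⊆X v∈E x∈E (F⊆X y∈F) v<y y<x) x∈D

        -- If `x` is `v`, the edge itself serves. Otherwise `x < v < y`, and right-filledness puts
        -- `v` in place of `x` while keeping `y`.
        gate-edge : ∀ {E x y} → v ∈ˢ X → Edge hypergraph E → E ⊆ˢ X → x ∈ˢ E → y ∈ˢ E → v < y → ¬ v < x →
                    ∃[ F ] Edge hypergraph F × F ⊆ˢ X × y ∈ˢ F × v ∈ˢ F
        gate-edge {E} {x} {y} v∈X e E⊆X x∈E y∈E v<y v≮x with x Fin.≟ v
        ... | yes refl = E , e , E⊆X , y∈E , x∈E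
        ... | no x≢v with fill (≮⇒≥ v≮x , x≢v) v<y e x∈E y∈E
        ...   | Y , eY , v∈Y , y∈Y , Y⊆ = Y , eY , Y⊆X , y∈Y , v∈Y
          where
          Y⊆X : Y ⊆ˢ X
          Y⊆X z∈Y with Y⊆ z∈Y
          ... | _ , inj₁ z∈E  = E⊆X z∈E
          ... | _ , inj₂ refl = v∈X

        closed : v ∈ˢ X → Closed X (comprehension reached?)
        closed v∈X {E} e E⊆X {x} {y} x∈E y∈E x∈ =
          ∈-comprehension⁺ reached? (step (∈-comprehension⁻ reached? x∈) (v <? y))
          where
          step : Reached x → Dec (v < y) → Reached y
          step (inj₁ (v<x , x∈D)) (yes v<y) with v ∈? E
          ... | yes v∈E = inj₁ (v<y , above e E⊆X x∈E v∈E e E⊆X y∈E v∈E v<x v<y x∈D)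
          ... | no  v∉E = inj₁ (v<y , clD e
            (λ z∈E → x∈p∧x≢y⇒x∈p-y (E⊆X z∈E) λ { refl → v∉E z∈E }) x∈E y∈E x∈D)
          -- The edge leaves the vertices larger than `v`, which makes `x` itself a gate.
          step (inj₁ (v<x , x∈D)) (no v≮y) =
            inj₂ (v≮y , x , v<x , x∈D , gate-edge v∈X e E⊆X y∈E x∈E v<x v≮y)
          step (inj₂ (v≮x , gate)) (no v≮y) = inj₂ (v≮y , gate)
          -- Both the gate `q` and `y` share an edge with `v`, so `above` transfers membership from
          -- `q` to `y`.
          step (inj₂ (v≮x , q , v<q , q∈D , F , f , F⊆X , q∈F , v∈F)) (yes v<y) =
            let G , g , G⊆X , y∈G , v∈G = gate-edge v∈X e E⊆X x∈E y∈E v<y v≮x in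
            inj₁ (v<y , above f F⊆X q∈F v∈F g G⊆X y∈G v∈G v<q v<y q∈D)

      -- Linkage in `X` is applied to the enlarged set of `Removal`; as `b` is larger than `v`,
      -- reaching `b` there means that `b` lies in `D`.
      Linked-remove₁ : ∀ {X v a b} → v < a → v < b → Linked X a b → Linked (X - v) a b
      Linked-remove₁ {X} {v} v<a v<b ab D clD a∈D with v ∈? X
      ... | no v∉X = ab D (λ e E⊆X → clD e λ x∈E → x∈p∧x≢y⇒x∈p-y (E⊆X x∈E) λ { refl → v∉X (E⊆X x∈E) }) a∈D
      ... | yes v∈X with ∈-comprehension⁻ reached?
                          (ab _ (closed v∈X) (∈-comprehension⁺ reached? (inj₁ (v<a , a∈D))))
        where open Removal v<a D clD
      ...   | inj₁ (_ , b∈D)  = b∈D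
      ...   | inj₂ (v≮b , _) = contradiction v<b v≮b

      Linked-removeAll : ∀ {X a b} vs → All (λ v → v < a × v < b) vs → Linked X a b → Linked (foldl _-_ X vs) a b
      Linked-removeAll []       []                 ab = ab
      Linked-removeAll (v ∷ vs) ((v<a , v<b) ∷ <s) ab = Linked-removeAll vs <s (Linked-remove₁ v<a v<b ab)

      ∈-removeAll⁻ : ∀ {X : Subset n} {x} vs → x ∈ˢ foldl _-_ X vs → x ∈ˢ X × x ∉ vs
      ∈-removeAll⁻ []       x∈ = x∈ , λ ()
      ∈-removeAll⁻ {X} (v ∷ vs) x∈ =
        let x∈X-v , x∉vs = ∈-removeAll⁻ vs x∈ ; x∈X , x∉v = x∈p─q⁻ X ⁅ v ⁆ x∈X-v in
        x∈X , λ { (here refl) → x∉v (x∈⁅x⁆ v) ; (there x∈vs) → x∉vs x∈vs }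

    -- The vertices of `V` are removed one by one. Each removal only compares the removed vertex
    -- with `a` and `b`, so their order is irrelevant.
    Linked-remove : ∀ {X V a b} → (∀ {v} → v ∈ˢ V → v < a × v < b) → Linked X a b → Linked (X ─ V) a b
    Linked-remove {X} {V} V< ab =
      Linked-mono (λ x∈ → let x∈X , x∉ = ∈-removeAll⁻ elements x∈ in x∈p∧x∉q⇒x∈p─q x∈X (x∉ ∘ elements⁺))
        (Linked-removeAll (elements {V}) (All.map V< elements⊆) ab)

    -- A vertex z outside of the component K cannot lie between two vertices of
    -- K: an edge of K crossing z could be refilled to join z to K.
    private
      one-side : ∀ {Z K z p q} → Closed Z K → K ⊆ˢ Z → Conn K → z ∈ˢ Z → z ∉ˢ K →
                 p ∈ˢ K → q ∈ˢ K → p < z → q < z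
      one-side {Z} {K} {z} clK K⊆Z conn z∈Z z∉K p∈K q∈K p<z =
        ∈-comprehension⁻ (_<? z) (conn p∈K q∈K _ cl (∈-comprehension⁺ (_<? z) p<z))
        where
        cl : Closed K (comprehension (_<? z))
        cl {E} e E⊆K {u} {v} u∈E v∈E u∈ with compare v z
        ... | tri< v<z _ _  = ∈-comprehension⁺ (_<? z) v<z
        ... | tri≈ _ refl _ = contradiction (E⊆K v∈E) z∉K
        ... | tri> _ _ z<v with fill (∈-comprehension⁻ (_<? z) u∈) z<v e u∈E v∈E
        ...   | Y , eY , z∈Y , v∈Y , Y⊆ = contradiction (clK eY Y⊆Z v∈Y z∈Y (E⊆K v∈E)) z∉K
          where
          Y⊆Z : Y ⊆ˢ Z
          Y⊆Z x∈Y with Y⊆ x∈Y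
          ... | _ , inj₁ x∈E  = K⊆Z (E⊆K x∈E)
          ... | _ , inj₂ refl = z∈Z

    -- By `one-side`, all of `K` lies below `l`. A vertex of `L` below some `x` in `K` would then
    -- leave `x` between two vertices of `L`.
    components-≪ : ∀ {Z K L k l} → Closed Z K → Closed Z L → K ⊆ˢ Z → L ⊆ˢ Z → Conn K → Conn L →
                   (∀ {x} → x ∈ˢ K → x ∉ˢ L) → k ∈ˢ K → l ∈ˢ L → k < l → K ≪ L
    components-≪ clK clL K⊆Z L⊆Z cK cL disj k∈K l∈L k<l {x} {y} x∈K y∈L = x<y
      where
      x<l : x < _
      x<l = one-side clK K⊆Z cK (L⊆Z l∈L) (λ l∈K → disj l∈K l∈L) k∈K x∈K k<l
      x<y : x < y
      x<y with compare x y
      ... | tri< x<y _ _  = x<y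
      ... | tri≈ _ refl _ = contradiction y∈L (disj x∈K)
      ... | tri> _ _ y<x  = contradiction (one-side clL L⊆Z cL (K⊆Z x∈K) (disj x∈K) y∈L l∈L y<x) (<-asym x<l)

-- Connected components, and constructs built on them.

AllPairs-lookup : ∀ {R : Rel I 0ℓ} {x y xs} → AllPairs R xs → x ∈ xs → y ∈ xs → x ≡ y ⊎ R x y ⊎ R y x
AllPairs-lookup (_  ∷ _)   (here refl) (here refl) = inj₁ refl
AllPairs-lookup (rs ∷ _)   (here refl) (there y∈)  = inj₂ (inj₁ (All.lookup rs y∈))
AllPairs-lookup (rs ∷ _)   (there x∈)  (here refl) = inj₂ (inj₂ (All.lookup rs x∈))
AllPairs-lookup (_  ∷ rss) (there x∈)  (there y∈)  = AllPairs-lookup rss x∈ y∈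

∈-⋃⁺ : ∀ {x : Fin n} {Ks} → Any (x ∈ˢ_) Ks → x ∈ˢ ⋃ Ks
∈-⋃⁺ (here x∈K)  = x∈p∪q⁺ (inj₁ x∈K)
∈-⋃⁺ (there x∈) = x∈p∪q⁺ (inj₂ (∈-⋃⁺ x∈))

∈-⋃⁻ : ∀ {x : Fin n} Ks → x ∈ˢ ⋃ Ks → Any (x ∈ˢ_) Ks
∈-⋃⁻ []       x∈ = contradiction x∈ ∉⊥
∈-⋃⁻ (K ∷ Ks) x∈ = [ here , there ∘ ∈-⋃⁻ Ks ]′ (x∈p∪q⁻ K (⋃ Ks) x∈)

Disjoint : Rel (Subset n) 0ℓ
Disjoint K L = ∀ x → x ∈ˢ K → x ∉ˢ L

module Decomposition (𝐇 : Hypergraph n) where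
  open Linkage 𝐇

  -- A positive counterpart of `Components`, with `Conn` in place of `Connected`. That the parts
  -- cover `Z` is contained in `edges`, because singletons are edges.
  record Parts (Z : Subset n) (Ks : List (Subset n)) : Set where
    field
      nonempties : All Nonempty Ks
      disjoint   : AllPairs Disjoint Ks
      within     : All (_⊆ˢ Z) Ks
      edges      : ∀ {E} → Edge 𝐇 E → E ⊆ˢ Z → Any (E ⊆ˢ_) Ks
      linked     : All Conn Ks

    cover : ∀ {x} → x ∈ˢ Z → ∃[ K ] K ∈ Ks × x ∈ˢ K
    cover {x} x∈Z with find (edges (singleton 𝐇 x) λ y∈ → subst (_∈ˢ Z) (sym (x∈⁅y⁆⇒x≡y x y∈)) x∈Z)
    ... | K , K∈ , x⊆K = K , K∈ , x⊆K (x∈⁅x⁆ x)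

    same : ∀ {K L x} → K ∈ Ks → L ∈ Ks → x ∈ˢ K → x ∈ˢ L → K ≡ L
    same K∈ L∈ x∈K x∈L with AllPairs-lookup disjoint K∈ L∈
    ... | inj₁ K≡L        = K≡L
    ... | inj₂ (inj₁ disj) = contradiction x∈L (disj _ x∈K)
    ... | inj₂ (inj₂ disj) = contradiction x∈K (disj _ x∈L)

    closed : ∀ {K} → K ∈ Ks → Closed Z K
    closed K∈ e E⊆Z x∈E y∈E x∈K with find (edges e E⊆Z)
    ... | L , L∈ , E⊆L with refl ← same K∈ L∈ x∈K (E⊆L x∈E) = E⊆L y∈E

  open Parts

  Parts-resp-↭ : ∀ {Z Ks Ls} → Ks ↭ Ls → Parts Z Ks → Parts Z Ls
  Parts-resp-↭ σ p = record
    { nonempties = ↭.All-resp-↭ σ (nonempties p)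
    ; disjoint   = AllPairs-resp-↭ (λ disj x x∈L x∈K → disj x x∈K x∈L) (resp₂ Disjoint) (↭⇒↭ₛ σ) (disjoint p)
    ; within     = ↭.All-resp-↭ σ (within p)
    ; edges      = λ e E⊆Z → ↭.Any-resp-↭ σ (edges p e E⊆Z)
    ; linked     = ↭.All-resp-↭ σ (linked p)
    }
    where open PermutationSetoid (setoid _) using (AllPairs-resp-↭)

  -- Two parts that share a vertex contain each other, since each is linked and the other is closed.
  -- So both lists have the same members, and neither has repetitions.
  Parts-unique : ∀ {Z Ks Ls} → Parts Z Ks → Parts Z Ls → Ks ↭ Ls
  Parts-unique {Z} p q = ∼bag⇒↭ (unique∧set⇒bag (unique p) (unique q) (mk⇔ (⊆ p q) (⊆ q p)))
    where
    unique : ∀ {Ks} → Parts Z Ks → AllPairs _≢_ Ks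
    unique p = go (nonempties p) (disjoint p)
      where
      go : ∀ {Ks} → All Nonempty Ks → AllPairs Disjoint Ks → AllPairs _≢_ Ks
      go []               []           = []
      go ((x , x∈K) ∷ ne) (disj ∷ djs) = All.map (λ { d refl → d x x∈K x∈K }) disj ∷ go ne djs
    ⊆ : ∀ {Ks Ls K} → Parts Z Ks → Parts Z Ls → K ∈ Ks → K ∈ Ls
    ⊆ p q K∈ with All.lookup (nonempties p) K∈
    ... | x , x∈K with cover q (All.lookup (within p) K∈ x∈K)
    ...   | L , L∈ , x∈L with refl ← ⊆-antisym {i = _} {j = L}
            (λ y∈K → Linked-mono (All.lookup (within p) K∈) (All.lookup (linked p) K∈ x∈K y∈K) _ (closed q L∈) x∈L)
            (λ y∈L → Linked-mono (All.lookup (within q) L∈) (All.lookup (linked q) L∈ x∈L y∈L) _ (closed p K∈) x∈K)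
            = L∈

  Components⇒Parts : ∀ {Z Ks} → Components 𝐇 Z Ks → Parts Z Ks
  Components⇒Parts {Z} {Ks} c = record
    { nonempties = Components.nonempties c
    ; disjoint   = AllPairs.map (λ empty _ x∈K x∈L → empty (_ , x∈p∩q⁺ (x∈K , x∈L))) (Components.disjoint c)
    ; within     = All.tabulate λ K∈ x∈K →
        subst (_ ∈ˢ_) (Components.vertices c) (∈-⋃⁺ (lose K∈ x∈K))
    ; edges      = λ e E⊆Z → Any.map proj₂ (proj₁ (Components.edges c) (e , λ {_} → E⊆Z))
    ; linked     = All.map Connected⇒Conn (Components.connected c)
    }

  Parts⇒Components : ∀ {Z Ks} → Parts Z Ks → Components 𝐇 Z Ks
  Parts⇒Components {Z} {Ks} p = record
    { nonempties = nonempties p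
    ; disjoint   = AllPairs.map (λ {K} {L} disj (x , x∈) → let x∈K , x∈L = x∈p∩q⁻ K L x∈ in disj x x∈K x∈L) (disjoint p)
    ; vertices   = ⊆-antisym
        (λ x∈ → let K , K∈ , x∈K = find (∈-⋃⁻ Ks x∈) in All.lookup (within p) K∈ x∈K)
        (λ x∈Z → let K , K∈ , x∈K = cover p x∈Z in ∈-⋃⁺ (lose K∈ x∈K))
    ; edges      = (λ {_} (e , E⊆Z) → Any.map (with-edge e) (edges p e E⊆Z))
                 , (λ {_} any → let K , K∈ , e , E⊆K = find any in e , λ {_} x∈E → All.lookup (within p) K∈ (E⊆K x∈E))
    ; connected  = All.map Conn⇒Connected (linked p)
    }
    where
    with-edge : ∀ {E K} → Edge 𝐇 E → E ⊆ˢ K → (𝐇 ↾ K) E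
    with-edge e E⊆K = e , E⊆K

  CX : Subset n → Set
  CX X = Σ[ T ∈ Tree n ] IsConstruct 𝐇 X T

  Child : Set
  Child = Σ[ K ∈ Subset n ] CX K

  set : Child → Subset n
  set = proj₁

  tree : Child → Tree n
  tree = proj₁ ∘ proj₂

  -- Covers both constructors of `IsConstruct`: if `Y` is all of `X`, then `X ─ Y` has no components
  -- and the tree is a single node.
  Branching : Subset n → Subset n → List Child → Set
  Branching X Y cs = Nonempty Y × Y ⊆ˢ X × Parts (X ─ Y) (map set cs)

  assemble : ∀ {X Y cs} → Branching X Y cs → IsConstruct 𝐇 X (node Y (map tree cs))
  assemble {X} {Y} {cs} (ne , Y⊆X , p) with X ⊆? Y
  ... | no X⊈Y = graft ne ((λ {_} → Y⊆X) , strict) (Parts⇒Components p) (children cs)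
    where
    children : ∀ cs → Pointwise (IsConstruct 𝐇) (map set cs) (map tree cs)
    children []                 = []
    children ((_ , _ , c) ∷ cs) = c ∷ children cs
    strict : ∃[ x ] x ∈ˢ X × x ∉ˢ Y
    strict with nonempty? (X ─ Y)
    ... | yes (x , x∈) = x , x∈p─q⁻ X Y x∈
    ... | no  empty    = ⊥-elim (X⊈Y X⊆Y)
      where
      X⊆Y : X ⊆ˢ Y
      X⊆Y {x} x∈X with x ∈? Y
      ... | yes x∈Y = x∈Y
      ... | no  x∉Y = contradiction (x , x∈p∧x∉q⇒x∈p─q x∈X x∉Y) empty
  ... | yes X⊆Y with refl ← ⊆-antisym X⊆Y Y⊆X with cs | nonempties p | within p
  ...   | []    | _            | _        = one ne
  ...   | _ ∷ _ | (x , x∈) ∷ _ | K⊆ ∷ _ = contradiction (p─q⊆p X X (K⊆ x∈)) (proj₂ (x∈p─q⁻ X X (K⊆ x∈)))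

  module _ (P : Subset n → Tree n → Set)
           (step : ∀ {X Y} cs → Branching X Y cs → All (λ c → P (set c) (tree c)) cs →
                   P X (node Y (map tree cs))) where

    -- Treats `one` as a branching without children, so that later proofs have a single case, and
    -- bundles each child with its vertex set.
    construct-induction : ∀ {X T} → IsConstruct 𝐇 X T → P X T
    private
      children : ∀ {Ks ts} → Pointwise (IsConstruct 𝐇) Ks ts →
        ∃[ cs ] map set cs ≡ Ks × map tree cs ≡ ts × All (λ c → P (set c) (tree c)) cs
      children []       = [] , refl , refl , []
      children (c ∷ cs) =
        let ds , eqK , eqt , ps = children cs in
        (_ , _ , c) ∷ ds , cong (_ ∷_) eqK , cong (_ ∷_) eqt , construct-induction c ∷ ps
    construct-induction (one {X} ne) = step [] (ne , (λ {_} z → z) , record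
      { nonempties = [] ; disjoint = [] ; within = [] ; linked = []
      ; edges = λ e E⊆ → let x , x∈E = nonempty 𝐇 e ; x∈X , x∉X = x∈p─q⁻ X X (E⊆ x∈E) in contradiction x∈X x∉X }) []
    construct-induction (graft ne Y⊂X comps cs) with children cs
    ... | ds , refl , refl , ps = step ds (ne , (λ {_} → proj₁ Y⊂X) , Components⇒Parts comps) ps

  data View (X : Subset n) : Tree n → Set where
    branching : ∀ {Y} cs → Branching X Y cs → View X (node Y (map tree cs))

  view : ∀ {X T} → IsConstruct 𝐇 X T → View X T
  view = construct-induction View (λ cs b _ → branching cs b)

  root-nonempty : ∀ {X T} → IsConstruct 𝐇 X T → Nonempty X
  root-nonempty c with branching _ ((x , x∈Y) , Y⊆X , _) ← view c = x , Y⊆X x∈Y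

-- Equality of non-planar trees.

≈-refl  : ∀ {T : Tree n} → T ≈ T
≈-refls : ∀ {ts : List (Tree n)} → Pointwise _≈_ ts ts
≈-refl {T = node X ts} = node (Permutation.refl ≈-refls)
≈-refls {ts = []}     = []
≈-refls {ts = t ∷ ts} = ≈-refl ∷ ≈-refls

-- Equality of trees is nested inside permutations and pointwise lists, so the recursion runs
-- through all three layers mutually.
≈-sym   : S ≈ T → T ≈ S
≈-symᵖ  : Permutation _≈_ ts us → Permutation _≈_ us ts
≈-syms  : Pointwise _≈_ ts us → Pointwise _≈_ us ts
≈-sym (node σ) = node (≈-symᵖ σ)
≈-symᵖ (Permutation.refl ps)     = Permutation.refl (≈-syms ps)
≈-symᵖ (Permutation.prep p σ)    = Permutation.prep (≈-sym p) (≈-symᵖ σ)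
≈-symᵖ (Permutation.swap p q σ)  = Permutation.swap (≈-sym q) (≈-sym p) (≈-symᵖ σ)
≈-symᵖ (Permutation.trans σ τ)   = Permutation.trans (≈-symᵖ τ) (≈-symᵖ σ)
≈-syms []       = []
≈-syms (p ∷ ps) = ≈-sym p ∷ ≈-syms ps

↭⇒Permutation : ts ↭ us → Permutation _≈_ ts us
↭⇒Permutation ↭.refl         = Permutation.refl ≈-refls
↭⇒Permutation (↭.prep _ σ)   = Permutation.prep ≈-refl (↭⇒Permutation σ)
↭⇒Permutation (↭.swap _ _ σ) = Permutation.swap ≈-refl ≈-refl (↭⇒Permutation σ)
↭⇒Permutation (↭.trans σ τ)  = Permutation.trans (↭⇒Permutation σ) (↭⇒Permutation τ)

≈-node : ts ↭ us → node X ts ≈ node X us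
≈-node σ = node (↭⇒Permutation σ)

∈ᴺ-resp-≈  : S ≈ T → A ∈ᴺ S → A ∈ᴺ T
∈ᴺ-resp-≈ᵖ : Permutation _≈_ ts us → Any (A ∈ᴺ_) ts → Any (A ∈ᴺ_) us
∈ᴺ-resp-≈s : Pointwise _≈_ ts us → Any (A ∈ᴺ_) ts → Any (A ∈ᴺ_) us
∈ᴺ-resp-≈ (node σ) here       = here
∈ᴺ-resp-≈ (node σ) (there A∈) = there (∈ᴺ-resp-≈ᵖ σ A∈)
∈ᴺ-resp-≈ᵖ (Permutation.refl ps)    A∈                 = ∈ᴺ-resp-≈s ps A∈
∈ᴺ-resp-≈ᵖ (Permutation.prep p σ)   (here A∈)          = here (∈ᴺ-resp-≈ p A∈)
∈ᴺ-resp-≈ᵖ (Permutation.prep p σ)   (there A∈)         = there (∈ᴺ-resp-≈ᵖ σ A∈)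
∈ᴺ-resp-≈ᵖ (Permutation.swap p q σ) (here A∈)          = there (here (∈ᴺ-resp-≈ p A∈))
∈ᴺ-resp-≈ᵖ (Permutation.swap p q σ) (there (here A∈))  = here (∈ᴺ-resp-≈ q A∈)
∈ᴺ-resp-≈ᵖ (Permutation.swap p q σ) (there (there A∈)) = there (there (∈ᴺ-resp-≈ᵖ σ A∈))
∈ᴺ-resp-≈ᵖ (Permutation.trans σ τ)  A∈                 = ∈ᴺ-resp-≈ᵖ τ (∈ᴺ-resp-≈ᵖ σ A∈)
∈ᴺ-resp-≈s (p ∷ ps) (here A∈)  = here (∈ᴺ-resp-≈ p A∈)
∈ᴺ-resp-≈s (p ∷ ps) (there A∈) = there (∈ᴺ-resp-≈s ps A∈)

Ancestor-resp-≈  : S ≈ T → Ancestor A B S → Ancestor A B T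
Ancestor-resp-≈ᵖ : Permutation _≈_ ts us → Any (Ancestor A B) ts → Any (Ancestor A B) us
Ancestor-resp-≈s : Pointwise _≈_ ts us → Any (Ancestor A B) ts → Any (Ancestor A B) us
Ancestor-resp-≈ (node σ) (here B∈)  = here (∈ᴺ-resp-≈ᵖ σ B∈)
Ancestor-resp-≈ (node σ) (there AB) = there (Ancestor-resp-≈ᵖ σ AB)
Ancestor-resp-≈ᵖ (Permutation.refl ps)    AB                 = Ancestor-resp-≈s ps AB
Ancestor-resp-≈ᵖ (Permutation.prep p σ)   (here AB)          = here (Ancestor-resp-≈ p AB)
Ancestor-resp-≈ᵖ (Permutation.prep p σ)   (there AB)         = there (Ancestor-resp-≈ᵖ σ AB)
Ancestor-resp-≈ᵖ (Permutation.swap p q σ) (here AB)          = there (here (Ancestor-resp-≈ p AB))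
Ancestor-resp-≈ᵖ (Permutation.swap p q σ) (there (here AB))  = here (Ancestor-resp-≈ q AB)
Ancestor-resp-≈ᵖ (Permutation.swap p q σ) (there (there AB)) = there (there (Ancestor-resp-≈ᵖ σ AB))
Ancestor-resp-≈ᵖ (Permutation.trans σ τ)  AB                 = Ancestor-resp-≈ᵖ τ (Ancestor-resp-≈ᵖ σ AB)
Ancestor-resp-≈s (p ∷ ps) (here AB)  = here (Ancestor-resp-≈ p AB)
Ancestor-resp-≈s (p ∷ ps) (there AB) = there (Ancestor-resp-≈s ps AB)

-- Vertices of a tree and the relations between them.

infix 4 _∈ᵗ_
_∈ᵗ_ : Fin n → Tree n → Set
x ∈ᵗ T = ∃[ A ] A ∈ᴺ T × x ∈ˢ A

∈ᵗ-here : x ∈ˢ X → x ∈ᵗ node X ts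
∈ᵗ-here x∈X = _ , here , x∈X

∈ᵗ-there : Any (x ∈ᵗ_) ts → x ∈ᵗ node X ts
∈ᵗ-there x∈ = let A , A∈ , x∈A = go x∈ in A , there A∈ , x∈A
  where
  go : Any (x ∈ᵗ_) ts → ∃[ A ] Any (A ∈ᴺ_) ts × x ∈ˢ A
  go (here (A , A∈ , x∈A)) = A , here A∈ , x∈A
  go (there x∈)            = let A , A∈ , x∈A = go x∈ in A , there A∈ , x∈A

∈ᵗ-inv : x ∈ᵗ node X ts → x ∈ˢ X ⊎ Any (x ∈ᵗ_) ts
∈ᵗ-inv (_ , here , x∈X)     = inj₁ x∈X
∈ᵗ-inv (A , there A∈ , x∈A) = inj₂ (Any.map (λ A∈t → A , A∈t , x∈A) A∈)

∈ᵗ-resp-≈ : S ≈ T → x ∈ᵗ S → x ∈ᵗ T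
∈ᵗ-resp-≈ p (A , A∈ , x∈A) = A , ∈ᴺ-resp-≈ p A∈ , x∈A

<ᵗ-here : x ∈ˢ X → Any (y ∈ᵗ_) ts → y <[ node X ts ] x
<ᵗ-here x∈X y∈ with find y∈
... | t , t∈ , B , B∈ , y∈B = _ , B , x∈X , y∈B , here (lose t∈ B∈)

<ᵗ-there : Any (λ t → y <[ t ] x) ts → y <[ node X ts ] x
<ᵗ-there y<x with find y<x
... | t , t∈ , A , B , x∈A , y∈B , AB = A , B , x∈A , y∈B , there (lose t∈ AB)

<ᵗ-inv : y <[ node X ts ] x → (x ∈ˢ X × Any (y ∈ᵗ_) ts) ⊎ Any (λ t → y <[ t ] x) ts
<ᵗ-inv (_ , B , x∈X , y∈B , here B∈)  = inj₁ (x∈X , Any.map (λ B∈t → B , B∈t , y∈B) B∈)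
<ᵗ-inv (A , B , x∈A , y∈B , there AB) = inj₂ (Any.map (λ ABt → A , B , x∈A , y∈B , ABt) AB)

<ᵗ-resp-≈ : S ≈ T → y <[ S ] x → y <[ T ] x
<ᵗ-resp-≈ p (A , B , x∈A , y∈B , AB) = A , B , x∈A , y∈B , Ancestor-resp-≈ p AB

=ᵗ-here : x ∈ˢ X → y ∈ˢ X → x =[ node X ts ] y
=ᵗ-here x∈X y∈X = _ , here , x∈X , y∈X

=ᵗ-there : Any (λ t → x =[ t ] y) ts → x =[ node X ts ] y
=ᵗ-there x=y with find x=y
... | t , t∈ , A , A∈ , x∈A , y∈A = A , there (lose t∈ A∈) , x∈A , y∈A

=ᵗ-inv : x =[ node X ts ] y → (x ∈ˢ X × y ∈ˢ X) ⊎ Any (λ t → x =[ t ] y) ts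
=ᵗ-inv (_ , here , x∈X , y∈X)      = inj₁ (x∈X , y∈X)
=ᵗ-inv (A , there A∈ , x∈A , y∈A) = inj₂ (Any.map (λ A∈t → A , A∈t , x∈A , y∈A) A∈)

=ᵗ-resp-≈ : S ≈ T → x =[ S ] y → x =[ T ] y
=ᵗ-resp-≈ p (A , A∈ , x∈A , y∈A) = A , ∈ᴺ-resp-≈ p A∈ , x∈A , y∈A

=ᵗ⇒∈ᵗ : x =[ T ] y → x ∈ᵗ T × y ∈ᵗ T
=ᵗ⇒∈ᵗ (A , A∈ , x∈A , y∈A) = (A , A∈ , x∈A) , (A , A∈ , y∈A)

Ancestor⇒∈ᴺ  : Ancestor A B T → A ∈ᴺ T × B ∈ᴺ T
Ancestor⇒∈ᴺs : Any (Ancestor A B) ts → Any (A ∈ᴺ_) ts × Any (B ∈ᴺ_) ts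
Ancestor⇒∈ᴺ (here B∈)  = here , there B∈
Ancestor⇒∈ᴺ (there AB) = let A∈ , B∈ = Ancestor⇒∈ᴺs AB in there A∈ , there B∈
Ancestor⇒∈ᴺs (here AB)  = let A∈ , B∈ = Ancestor⇒∈ᴺ AB in here A∈ , here B∈
Ancestor⇒∈ᴺs (there AB) = let A∈ , B∈ = Ancestor⇒∈ᴺs AB in there A∈ , there B∈

<ᵗ⇒∈ᵗ : y <[ T ] x → y ∈ᵗ T × x ∈ᵗ T
<ᵗ⇒∈ᵗ (A , B , x∈A , y∈B , AB) = let A∈ , B∈ = Ancestor⇒∈ᴺ AB in (B , B∈ , y∈B) , (A , A∈ , x∈A)

-- The effect of contracting an edge on these relations.

module _ {U V : Subset n} where

  private
    cong-∷ : ∀ {P : Tree n → Set} {S T ts} → (P S → P T) → Any P (S ∷ ts) → Any P (T ∷ ts)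
    cong-∷ f (here p)  = here (f p)
    cong-∷ f (there p) = there p

  contract-∈⁺ : S ⊂[ U , V ] T → x ∈ᵗ S → x ∈ᵗ T
  contract-∈⁺ (here {ts} {us} S≈ T≈) x∈ = ∈ᵗ-resp-≈ (≈-sym T≈) (merge (∈ᵗ-inv (∈ᵗ-resp-≈ S≈ x∈)))
    where
    merge : x ∈ˢ U ⊎ Any (x ∈ᵗ_) (node V us ∷ ts) → x ∈ᵗ node (U Sub.∪ V) (us ++ ts)
    merge (inj₁ x∈U)         = ∈ᵗ-here (x∈p∪q⁺ (inj₁ x∈U))
    merge (inj₂ (here x∈))  = [ ∈ᵗ-here ∘ x∈p∪q⁺ ∘ inj₂ , ∈ᵗ-there ∘ Any.++⁺ˡ ]′ (∈ᵗ-inv x∈)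
    merge (inj₂ (there x∈)) = ∈ᵗ-there (Any.++⁺ʳ us x∈)
  contract-∈⁺ (there S≈ T≈ S⊂T) x∈ =
    ∈ᵗ-resp-≈ (≈-sym T≈) ([ ∈ᵗ-here , ∈ᵗ-there ∘ cong-∷ (contract-∈⁺ S⊂T) ]′ (∈ᵗ-inv (∈ᵗ-resp-≈ S≈ x∈)))

  contract-∈⁻ : S ⊂[ U , V ] T → x ∈ᵗ T → x ∈ᵗ S
  contract-∈⁻ (here {ts} {us} S≈ T≈) x∈ = ∈ᵗ-resp-≈ (≈-sym S≈) (split (∈ᵗ-inv (∈ᵗ-resp-≈ T≈ x∈)))
    where
    split : x ∈ˢ U Sub.∪ V ⊎ Any (x ∈ᵗ_) (us ++ ts) → x ∈ᵗ node U (node V us ∷ ts)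
    split (inj₁ x∈UV) = [ ∈ᵗ-here , ∈ᵗ-there ∘ Any.here ∘ ∈ᵗ-here ]′ (x∈p∪q⁻ U V x∈UV)
    split (inj₂ x∈)   = ∈ᵗ-there ([ Any.here ∘ ∈ᵗ-there , Any.there ]′ (Any.++⁻ us x∈))
  contract-∈⁻ (there S≈ T≈ S⊂T) x∈ =
    ∈ᵗ-resp-≈ (≈-sym S≈) ([ ∈ᵗ-here , ∈ᵗ-there ∘ cong-∷ (contract-∈⁻ S⊂T) ]′ (∈ᵗ-inv (∈ᵗ-resp-≈ T≈ x∈)))

  contract-=⁺ : S ⊂[ U , V ] T → x =[ S ] y → x =[ T ] y
  contract-=⁺ {x = x} {y} (here {ts} {us} S≈ T≈) x=y = =ᵗ-resp-≈ (≈-sym T≈) (merge (=ᵗ-inv (=ᵗ-resp-≈ S≈ x=y)))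
    where
    merge : (x ∈ˢ U × y ∈ˢ U) ⊎ Any (λ t → x =[ t ] y) (node V us ∷ ts) → x =[ node (U Sub.∪ V) (us ++ ts) ] y
    merge (inj₁ (x∈U , y∈U))  = =ᵗ-here (x∈p∪q⁺ (inj₁ x∈U)) (x∈p∪q⁺ (inj₁ y∈U))
    merge (inj₂ (here x=y))  = [ (λ (x∈V , y∈V) → =ᵗ-here (x∈p∪q⁺ (inj₂ x∈V)) (x∈p∪q⁺ (inj₂ y∈V)))
                               , =ᵗ-there ∘ Any.++⁺ˡ ]′ (=ᵗ-inv x=y)
    merge (inj₂ (there x=y)) = =ᵗ-there (Any.++⁺ʳ us x=y)
  contract-=⁺ (there S≈ T≈ S⊂T) x=y =
    =ᵗ-resp-≈ (≈-sym T≈) ([ (λ (x∈ , y∈) → =ᵗ-here x∈ y∈) , =ᵗ-there ∘ cong-∷ (contract-=⁺ S⊂T) ]′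
                            (=ᵗ-inv (=ᵗ-resp-≈ S≈ x=y)))

  -- New equalities arise only across the contracted edge, where the vertex of `U` used to be above
  -- the vertex of `V`.
  contract-=⁻ : S ⊂[ U , V ] T → x =[ T ] y →
                x =[ S ] y ⊎ (x ∈ˢ U × y ∈ˢ V × y <[ S ] x) ⊎ (x ∈ˢ V × y ∈ˢ U × x <[ S ] y)
  contract-=⁻ {x = x} {y} (here {ts} {us} S≈ T≈) x=y =
    Sum.map (=ᵗ-resp-≈ (≈-sym S≈))
            (Sum.map (λ (x∈ , y∈) → x∈ , y∈ , <ᵗ-resp-≈ (≈-sym S≈) (<ᵗ-here x∈ (here (∈ᵗ-here y∈))))
                     (λ (x∈ , y∈) → x∈ , y∈ , <ᵗ-resp-≈ (≈-sym S≈) (<ᵗ-here y∈ (here (∈ᵗ-here x∈)))))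
            (split (=ᵗ-inv (=ᵗ-resp-≈ T≈ x=y)))
    where
    split : (x ∈ˢ U Sub.∪ V × y ∈ˢ U Sub.∪ V) ⊎ Any (λ t → x =[ t ] y) (us ++ ts) →
            x =[ node U (node V us ∷ ts) ] y ⊎ (x ∈ˢ U × y ∈ˢ V) ⊎ (x ∈ˢ V × y ∈ˢ U)
    split (inj₁ (x∈ , y∈)) with x∈p∪q⁻ U V x∈ | x∈p∪q⁻ U V y∈
    ... | inj₁ x∈U | inj₁ y∈U = inj₁ (=ᵗ-here x∈U y∈U)
    ... | inj₁ x∈U | inj₂ y∈V = inj₂ (inj₁ (x∈U , y∈V))
    ... | inj₂ x∈V | inj₁ y∈U = inj₂ (inj₂ (x∈V , y∈U))
    ... | inj₂ x∈V | inj₂ y∈V = inj₁ (=ᵗ-there (here (=ᵗ-here x∈V y∈V)))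
    split (inj₂ x=y) = inj₁ (=ᵗ-there ([ Any.here ∘ =ᵗ-there , Any.there ]′ (Any.++⁻ us x=y)))
  contract-=⁻ {x = x} {y} (there {ts = ts} S≈ T≈ S⊂T) x=y with =ᵗ-inv (=ᵗ-resp-≈ T≈ x=y)
  ... | inj₁ (x∈ , y∈) = inj₁ (=ᵗ-resp-≈ (≈-sym S≈) (=ᵗ-here x∈ y∈))
  ... | inj₂ (there x=y) = inj₁ (=ᵗ-resp-≈ (≈-sym S≈) (=ᵗ-there (there x=y)))
  ... | inj₂ (here x=y) =
    Sum.map (=ᵗ-resp-≈ (≈-sym S≈) ∘ =ᵗ-there ∘ here)
            (Sum.map (λ (x∈ , y∈ , y<x) → x∈ , y∈ , <ᵗ-resp-≈ (≈-sym S≈) (<ᵗ-there (here y<x)))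
                     (λ (x∈ , y∈ , x<y) → x∈ , y∈ , <ᵗ-resp-≈ (≈-sym S≈) (<ᵗ-there (here x<y))))
            (contract-=⁻ S⊂T x=y)

  -- The merged node stays above everything that was below `U` or below `V`; the only relation lost
  -- is that of `U` over `V` itself.
  contract-<⁺ : S ⊂[ U , V ] T → y <[ S ] x → y <[ T ] x ⊎ (x ∈ˢ U × y ∈ˢ V)
  contract-<⁺ {y = y} {x} (here {ts} {us} S≈ T≈) y<x =
    Sum.map₁ (<ᵗ-resp-≈ (≈-sym T≈)) (merge (<ᵗ-inv (<ᵗ-resp-≈ S≈ y<x)))
    where
    merge : (x ∈ˢ U × Any (y ∈ᵗ_) (node V us ∷ ts)) ⊎ Any (λ t → y <[ t ] x) (node V us ∷ ts) →
            y <[ node (U Sub.∪ V) (us ++ ts) ] x ⊎ (x ∈ˢ U × y ∈ˢ V)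
    merge (inj₁ (x∈U , here y∈)) with ∈ᵗ-inv y∈
    ... | inj₁ y∈V = inj₂ (x∈U , y∈V)
    ... | inj₂ y∈  = inj₁ (<ᵗ-here (x∈p∪q⁺ (inj₁ x∈U)) (Any.++⁺ˡ y∈))
    merge (inj₁ (x∈U , there y∈)) = inj₁ (<ᵗ-here (x∈p∪q⁺ (inj₁ x∈U)) (Any.++⁺ʳ us y∈))
    merge (inj₂ (here y<x))  = inj₁ ([ (λ (x∈V , y∈) → <ᵗ-here (x∈p∪q⁺ (inj₂ x∈V)) (Any.++⁺ˡ y∈))
                                     , <ᵗ-there ∘ Any.++⁺ˡ ]′ (<ᵗ-inv y<x))
    merge (inj₂ (there y<x)) = inj₁ (<ᵗ-there (Any.++⁺ʳ us y<x))
  contract-<⁺ (there S≈ T≈ S⊂T) y<x with <ᵗ-inv (<ᵗ-resp-≈ S≈ y<x)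
  ... | inj₁ (x∈ , y∈)   = inj₁ (<ᵗ-resp-≈ (≈-sym T≈) (<ᵗ-here x∈ (cong-∷ (contract-∈⁺ S⊂T) y∈)))
  ... | inj₂ (there y<x) = inj₁ (<ᵗ-resp-≈ (≈-sym T≈) (<ᵗ-there (there y<x)))
  ... | inj₂ (here y<x)  = Sum.map₁ (<ᵗ-resp-≈ (≈-sym T≈) ∘ <ᵗ-there ∘ here) (contract-<⁺ S⊂T y<x)

-- Vertex sets of constructs and relations seen from the root.

module Constructs (𝐇 : Hypergraph n) where
  open Linkage 𝐇
  open Decomposition 𝐇 public
  open Parts

  branches : ∀ {X Y ts} → IsConstruct 𝐇 X (node Y ts) → ∃[ cs ] map tree cs ≡ ts × Branching X Y cs
  branches c with branching cs b ← view c = cs , refl , b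

  construct-resp-≈ : ∀ {X S T} → S ≈ T → IsConstruct 𝐇 X S → IsConstruct 𝐇 X T
  private
    resp-perm : ∀ {ts us} cs → map tree cs ≡ ts → Permutation _≈_ ts us →
                ∃[ ds ] map tree ds ≡ us × map set cs ↭ map set ds
    resp-pointwise : ∀ {ts us} cs → map tree cs ≡ ts → Pointwise _≈_ ts us →
                     ∃[ ds ] map tree ds ≡ us × map set cs ≡ map set ds
  construct-resp-≈ (node σ) c with branches c
  ... | cs , refl , ne , Y⊆X , p with resp-perm cs refl σ
  ...   | ds , refl , τ = assemble (ne , (λ {_} → Y⊆X) , Parts-resp-↭ τ p)
  resp-perm cs eq (Permutation.refl ps) = let ds , eq , eqK = resp-pointwise cs eq ps in ds , eq , ↭.↭-reflexive eqK
  resp-perm ((K , s , c) ∷ cs) refl (Permutation.prep p σ) with resp-perm cs refl σ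
  ... | ds , refl , τ = (K , _ , construct-resp-≈ p c) ∷ ds , refl , ↭.prep K τ
  resp-perm ((K , s , c) ∷ (L , t , d) ∷ cs) refl (Permutation.swap p q σ) with resp-perm cs refl σ
  ... | ds , refl , τ =
    (L , _ , construct-resp-≈ q d) ∷ (K , _ , construct-resp-≈ p c) ∷ ds , refl , ↭.swap K L τ
  resp-perm cs eq (Permutation.trans σ τ) with resp-perm cs eq σ
  ... | ds , eq′ , σ′ with resp-perm ds eq′ τ
  ...   | es , eq″ , τ′ = es , eq″ , ↭.trans σ′ τ′
  resp-pointwise []                 refl []       = [] , refl , refl
  resp-pointwise ((K , s , c) ∷ cs) refl (p ∷ ps) with resp-pointwise cs refl ps
  ... | ds , refl , eq = (K , _ , construct-resp-≈ p c) ∷ ds , refl , cong (K ∷_) eq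

  any-child⁻ : ∀ {P : Tree n → Set} {cs} → Any P (map tree cs) → ∃[ c ] c ∈ cs × P (tree c)
  any-child⁻ = find ∘ Any.map⁻

  any-child⁺ : ∀ {P : Tree n → Set} {c cs} → c ∈ cs → P (tree c) → Any P (map tree cs)
  any-child⁺ c∈ p = Any.map⁺ (lose c∈ p)

  private
    Supports : Subset n → Tree n → Set
    Supports X T = ∀ {x} → (x ∈ˢ X → x ∈ᵗ T) × (x ∈ᵗ T → x ∈ˢ X)

    support : ∀ {X T} → IsConstruct 𝐇 X T → Supports X T
    support = construct-induction Supports step
      where
      step : ∀ {X Y} cs → Branching X Y cs → All (λ c → Supports (set c) (tree c)) cs → Supports X (node Y (map tree cs))
      step {X} {Y} cs (_ , Y⊆X , p) ih {x} = to , from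
        where
        to : x ∈ˢ X → x ∈ᵗ node Y (map tree cs)
        to x∈X with x ∈? Y
        ... | yes x∈Y = ∈ᵗ-here x∈Y
        ... | no  x∉Y with cover p (x∈p∧x∉q⇒x∈p─q x∈X x∉Y)
        ...   | K , K∈ , x∈K with ∈-map⁻ set K∈
        ...     | c , c∈ , refl = ∈ᵗ-there (any-child⁺ c∈ (proj₁ (All.lookup ih c∈) x∈K))
        from : x ∈ᵗ node Y (map tree cs) → x ∈ˢ X
        from x∈ with ∈ᵗ-inv x∈
        ... | inj₁ x∈Y = Y⊆X x∈Y
        ... | inj₂ x∈cs with any-child⁻ x∈cs
        ...   | c , c∈ , x∈c = p─q⊆p X Y (All.lookup (within p) (∈-map⁺ set c∈) (proj₂ (All.lookup ih c∈) x∈c))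

  support⁺ : ∀ {X T x} → IsConstruct 𝐇 X T → x ∈ˢ X → x ∈ᵗ T
  support⁺ c = proj₁ (support c)

  support⁻ : ∀ {X T x} → IsConstruct 𝐇 X T → x ∈ᵗ T → x ∈ˢ X
  support⁻ c = proj₂ (support c)

  child-of : ∀ {cs : List Child} {x} → Any (x ∈ᵗ_) (map tree cs) → ∃[ c ] c ∈ cs × x ∈ˢ set c
  child-of x∈ with any-child⁻ x∈
  ... | c , c∈ , x∈c = c , c∈ , support⁻ (proj₂ (proj₂ c)) x∈c

  module Root {X Y cs} (b : Branching X Y cs) where
    private
      p : Parts (X ─ Y) (map set cs)
      p = proj₂ (proj₂ b)

    cover-child : ∀ {x} → x ∈ˢ X → x ∉ˢ Y → ∃[ c ] c ∈ cs × x ∈ˢ set c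
    cover-child x∈X x∉Y with cover p (x∈p∧x∉q⇒x∈p─q x∈X x∉Y)
    ... | K , K∈ , x∈K with ∈-map⁻ set K∈
    ...   | c , c∈ , refl = c , c∈ , x∈K

    child⊆ : ∀ {c x} → c ∈ cs → x ∈ˢ set c → x ∈ˢ X × x ∉ˢ Y
    child⊆ c∈ x∈c = x∈p─q⁻ X Y (All.lookup (within p) (∈-map⁺ set c∈) x∈c)

    child-conn : ∀ {c} → c ∈ cs → Conn (set c)
    child-conn c∈ = All.lookup (linked p) (∈-map⁺ set c∈)

    below-root : ∀ {x y} → x ∈ˢ Y → y ∈ˢ X → y ∉ˢ Y → y <[ node Y (map tree cs) ] x
    below-root x∈Y y∈X y∉Y with cover-child y∈X y∉Y
    ... | c , c∈ , y∈c = <ᵗ-here x∈Y (any-child⁺ c∈ (support⁺ (proj₂ (proj₂ c)) y∈c))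

    -- The relation is witnessed by some node containing `y`. Such a node would lie in a child, and
    -- children are disjoint from the root.
    root-top : ∀ {x y} → y ∈ˢ Y → ¬ y <[ node Y (map tree cs) ] x
    root-top y∈Y y<x with <ᵗ-inv y<x
    ... | inj₁ (_ , y∈) = let c , c∈ , y∈c = child-of y∈ in proj₂ (child⊆ c∈ y∈c) y∈Y
    ... | inj₂ y<x with any-child⁻ y<x
    ...   | c , c∈ , y<x = proj₂ (child⊆ c∈ (support⁻ (proj₂ (proj₂ c)) (proj₁ (<ᵗ⇒∈ᵗ y<x)))) y∈Y

    root-= : ∀ {x y} → x =[ node Y (map tree cs) ] y → (x ∈ˢ Y → y ∈ˢ Y) × (y ∈ˢ Y → x ∈ˢ Y)
    root-= x=y with =ᵗ-inv x=y
    ... | inj₁ (x∈Y , y∈Y) = (λ _ → y∈Y) , (λ _ → x∈Y)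
    ... | inj₂ x=y with any-child⁻ x=y
    ...   | c , c∈ , x=y with =ᵗ⇒∈ᵗ x=y
    ...     | x∈c , y∈c = (λ x∈Y → contradiction x∈Y (proj₂ (child⊆ c∈ (support⁻ (proj₂ (proj₂ c)) x∈c))))
                        , (λ y∈Y → contradiction y∈Y (proj₂ (child⊆ c∈ (support⁻ (proj₂ (proj₂ c)) y∈c))))

    same-child : ∀ {c d x} → c ∈ cs → d ∈ cs → x ∈ˢ set c → x ∈ˢ set d → c ≡ d
    same-child c∈ d∈ x∈c x∈d with AllPairs-lookup (AllPairs.map⁻ (disjoint p)) c∈ d∈
    ... | inj₁ c≡d        = c≡d
    ... | inj₂ (inj₁ disj) = contradiction x∈d (disj _ x∈c)
    ... | inj₂ (inj₂ disj) = contradiction x∈c (disj _ x∈d)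

    in-child-< : ∀ {c x y} → c ∈ cs → x ∈ˢ set c → y <[ node Y (map tree cs) ] x → y <[ tree c ] x
    in-child-< c∈ x∈c y<x with <ᵗ-inv y<x
    ... | inj₁ (x∈Y , _) = contradiction x∈Y (proj₂ (child⊆ c∈ x∈c))
    ... | inj₂ y<x with any-child⁻ y<x
    ...   | d , d∈ , y<x with refl ← same-child d∈ c∈ (support⁻ (proj₂ (proj₂ d)) (proj₂ (<ᵗ⇒∈ᵗ y<x))) x∈c = y<x

    in-child-= : ∀ {c x y} → c ∈ cs → x ∈ˢ set c → x =[ node Y (map tree cs) ] y → x =[ tree c ] y
    in-child-= c∈ x∈c x=y with =ᵗ-inv x=y
    ... | inj₁ (x∈Y , _) = contradiction x∈Y (proj₂ (child⊆ c∈ x∈c))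
    ... | inj₂ x=y with any-child⁻ x=y
    ...   | d , d∈ , x=y with refl ← same-child d∈ c∈ (support⁻ (proj₂ (proj₂ d)) (proj₁ (=ᵗ⇒∈ᵗ x=y))) x∈c = x=y

-- Fusions and splits respect inversions.

module Soundness (𝐎 : OrderedHypergraph n) (rf : OrderedHypergraph.RightFilled 𝐎) where
  open Ordering 𝐎
  open Constructs hypergraph
  open Parts

  -- Contraction creates new relations by putting the other subtrees of `U` below `V`. If `x` is in
  -- `V` and `x < y`, both are larger than all of `U`, so right-filledness keeps them linked after
  -- the removal of `U`. Thus `y` is in the child rooted at `V` and not in another subtree.
  contract-<⁻ : ∀ {X S T U V x y} → S ⊂[ U , V ] T → U ≪ V → IsConstruct hypergraph X S → Conn X →
                x < y → y <[ T ] x → y <[ S ] x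
  contract-<⁻ {X} {U = U} {V} {x} {y} (here {ts} {us} S≈ T≈) U≪V c conn x<y y<x with construct-resp-≈ S≈ c
  ... | c′ with branches c′
  ...   | d ∷ ds , refl , b = <ᵗ-resp-≈ (≈-sym S≈) (split (<ᵗ-inv (<ᵗ-resp-≈ T≈ y<x)))
    where
    open Root {cs = d ∷ ds} b
    x∈d : x ∈ˢ V → x ∈ˢ set d
    x∈d x∈V = support⁻ (proj₂ (proj₂ d)) (∈ᵗ-here x∈V)
    y∈d : x ∈ˢ V → y ∈ˢ X → y ∈ˢ set d
    y∈d x∈V y∈X = Linked-remove rf (λ u∈U → U≪V u∈U x∈V , <-trans (U≪V u∈U x∈V) x<y)
      (conn (proj₁ (child⊆ (here refl) (x∈d x∈V))) y∈X) _
      (closed (proj₂ (proj₂ b)) (here refl)) (x∈d x∈V)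
    split : (x ∈ˢ U Sub.∪ V × Any (y ∈ᵗ_) (us ++ ts)) ⊎ Any (λ t → y <[ t ] x) (us ++ ts) →
            y <[ node U (node V us ∷ ts) ] x
    split (inj₁ (x∈UV , y∈)) with x∈p∪q⁻ U V x∈UV | Any.++⁻ us y∈
    ... | inj₁ x∈U | inj₁ y∈us = <ᵗ-here x∈U (here (∈ᵗ-there y∈us))
    ... | inj₁ x∈U | inj₂ y∈ts = <ᵗ-here x∈U (there y∈ts)
    ... | inj₂ x∈V | inj₁ y∈us = <ᵗ-there (here (<ᵗ-here x∈V y∈us))
    ... | inj₂ x∈V | inj₂ y∈ts with child-of y∈ts
    ...   | e , e∈ , y∈e = contradiction y∈e
      (All.lookup (AllPairs.head (disjoint (proj₂ (proj₂ b)))) (∈-map⁺ set e∈) y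
        (y∈d x∈V (proj₁ (child⊆ (there e∈) y∈e))))
    split (inj₂ y<x) = <ᵗ-there ([ Any.here ∘ <ᵗ-there , Any.there ]′ (Any.++⁻ us y<x))
  contract-<⁻ {x = x} {y} (there {Z} {S′} {T′} {ts} S≈ T≈ S⊂T) U≪V c conn x<y y<x
    with construct-resp-≈ S≈ c
  ... | c′ with branches c′
  ...   | d ∷ ds , refl , b with <ᵗ-inv (<ᵗ-resp-≈ T≈ y<x)
  ...     | inj₁ (x∈Z , here y∈)  = <ᵗ-resp-≈ (≈-sym S≈) (<ᵗ-here x∈Z (here (contract-∈⁻ S⊂T y∈)))
  ...     | inj₁ (x∈Z , there y∈) = <ᵗ-resp-≈ (≈-sym S≈) (<ᵗ-here x∈Z (there y∈))
  ...     | inj₂ (there y<x)      = <ᵗ-resp-≈ (≈-sym S≈) (<ᵗ-there (there y<x))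
  ...     | inj₂ (here y<x)       = <ᵗ-resp-≈ (≈-sym S≈) (<ᵗ-there (here
    (contract-<⁻ S⊂T U≪V (proj₂ (proj₂ d)) (Root.child-conn {cs = d ∷ ds} b (here refl)) x<y y<x)))

  infix 4 _⊑_
  -- The two inclusions of the theorem for bare trees, whatever their vertex sets, so that they can
  -- be restricted to subtrees.
  _⊑_ : Tree n → Tree n → Set
  S ⊑ T = (∀ {a b} → a < b → b <[ S ] a → b <[ T ] a)
        × (∀ {a b} → a < b → a =[ S ] b → a =[ T ] b ⊎ b <[ T ] a)

  ⊑-trans : ∀ {S T R} → S ⊑ T → T ⊑ R → S ⊑ R
  ⊑-trans (inv , inv~) (inv′ , inv~′) =
    (λ a<b → inv′ a<b ∘ inv a<b) , (λ a<b → [ inv~′ a<b , inj₂ ∘ inv′ a<b ]′ ∘ inv~ a<b)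

  ≈⇒⊑ : ∀ {S T} → S ≈ T → S ⊑ T
  ≈⇒⊑ p = (λ _ → <ᵗ-resp-≈ p) , (λ _ → inj₁ ∘ =ᵗ-resp-≈ p)

  -- A lost relation has its upper vertex in `U` and its lower one in `V`. Since `V ≪ U`, it was not
  -- an inversion.
  fusion⇒⊑ : ∀ {S T U V} → V ≪ U → S ⊂[ U , V ] T → S ⊑ T
  fusion⇒⊑ V≪U S⊂T =
    (λ a<b b<a → [ (λ z → z) , (λ (a∈U , b∈V) → contradiction (V≪U b∈V a∈U) (<-asym a<b)) ]′ (contract-<⁺ S⊂T b<a))
    , (λ _ → inj₁ ∘ contract-=⁺ S⊂T)

  -- An equality broken by the split joins `V` to `U`. As `V` is now on top and `V ≪ U`, the pair
  -- has become an inversion.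
  split⇒⊑ : ∀ {X S T U V} → Conn X → IsConstruct hypergraph X T → V ≪ U → T ⊂[ V , U ] S → S ⊑ T
  split⇒⊑ {S = S} {T} {U} {V} conn c V≪U T⊂S = (λ a<b → contract-<⁻ T⊂S V≪U c conn a<b) , inv~
    where
    inv~ : ∀ {a b} → a < b → a =[ S ] b → a =[ T ] b ⊎ b <[ T ] a
    inv~ a<b a=b with contract-=⁻ T⊂S a=b
    ... | inj₁ a=b                    = inj₁ a=b
    ... | inj₂ (inj₁ (_ , _ , b<a))   = inj₂ b<a
    ... | inj₂ (inj₂ (a∈U , b∈V , _)) = contradiction (V≪U b∈V a∈U) (<-asym a<b)

-- Components after a fusion or a split at the root.

AllPairs-++⁻ : ∀ {R : Rel I 0ℓ} xs {ys} → AllPairs R (xs ++ ys) →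
               AllPairs R xs × AllPairs R ys × All (λ x → All (R x) ys) xs
AllPairs-++⁻ []       rss        = [] , rss , []
AllPairs-++⁻ (x ∷ xs) (rs ∷ rss) =
  let rxs , rys = All.++⁻ xs rs ; xss , yss , cross = AllPairs-++⁻ xs rss in
  rxs ∷ xss , yss , rys ∷ cross

separate : ∀ {P : Pred I 0ℓ} → Decidable P → ∀ xs → ∃[ ys ] ∃[ zs ] xs ↭ ys ++ zs × All P ys × All (λ x → ¬ P x) zs
separate P? [] = [] , [] , ↭.refl , [] , []
separate P? (x ∷ xs) with P? x | separate P? xs
... | yes px | ys , zs , σ , pys , nzs = x ∷ ys , zs , ↭.prep x σ , px ∷ pys , nzs
... | no ¬px | ys , zs , σ , pys , nzs =
  ys , x ∷ zs , ↭.trans (↭.prep x σ) (↭.↭-sym (↭.shift x ys zs)) , pys , ¬px ∷ nzs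

module PartsFusion (𝐇 : Hypergraph n) where
  open Linkage 𝐇
  open Decomposition 𝐇
  open Parts

  -- Removing `C` breaks up only the component `K`, since `C ⊆ˢ K` is disjoint from the others. An
  -- edge that avoids `R` and `C` lies in another component or in a part of `K ─ C`.
  Parts-fuse : ∀ {X R C K Ks Ls} → C ⊆ˢ K → Parts (X ─ R) (K ∷ Ks) → Parts (K ─ C) Ls →
               Parts (X ─ (R Sub.∪ C)) (Ls ++ Ks)
  Parts-fuse {X} {R} {C} {K} {Ks} {Ls} C⊆K p q = record
    { nonempties = All.++⁺ (nonempties q) (All.tail (nonempties p))
    ; disjoint   = AllPairs.++⁺ (disjoint q) (AllPairs.tail (disjoint p))
        (All.tabulate λ L∈ → All.map (λ disj x x∈L → disj x (p─q⊆p K C (All.lookup (within q) L∈ x∈L))) K-disjoint)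
    ; within     = All.++⁺ (All.tabulate λ L∈ x∈L → from-K (All.lookup (within q) L∈ x∈L))
        (All.tabulate λ M∈ x∈M → from-other (All.lookup K-disjoint M∈) (All.lookup (within p) (there M∈)) x∈M)
    ; edges      = edges′
    ; linked     = All.++⁺ (linked q) (All.tail (linked p))
    }
    where
    K-disjoint : All (Disjoint K) Ks
    K-disjoint = AllPairs.head (disjoint p)
    from-K : K ─ C ⊆ˢ X ─ (R Sub.∪ C)
    from-K x∈ =
      let x∈K , x∉C = x∈p─q⁻ K C x∈ ; x∈X , x∉R = x∈p─q⁻ X R (All.head (within p) x∈K) in
      x∈p∧x∉q⇒x∈p─q x∈X ([ x∉R , x∉C ]′ ∘ x∈p∪q⁻ R C)
    from-other : ∀ {M} → Disjoint K M → M ⊆ˢ X ─ R → M ⊆ˢ X ─ (R Sub.∪ C)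
    from-other disj M⊆ x∈M =
      let x∈X , x∉R = x∈p─q⁻ X R (M⊆ x∈M) in
      x∈p∧x∉q⇒x∈p─q x∈X ([ x∉R , (λ x∈C → disj _ (C⊆K x∈C) x∈M) ]′ ∘ x∈p∪q⁻ R C)
    edges′ : ∀ {E} → Edge 𝐇 E → E ⊆ˢ X ─ (R Sub.∪ C) → Any (E ⊆ˢ_) (Ls ++ Ks)
    edges′ {E} e E⊆ with edges p e (λ x∈E → let x∈X , x∉RC = x∈p─q⁻ X _ (E⊆ x∈E) in
                                     x∈p∧x∉q⇒x∈p─q x∈X (x∉RC ∘ x∈p∪q⁺ ∘ inj₁))
    ... | here E⊆K   = Any.++⁺ˡ (edges q e λ x∈E →
      x∈p∧x∉q⇒x∈p─q (E⊆K x∈E) (proj₂ (x∈p─q⁻ X _ (E⊆ x∈E)) ∘ x∈p∪q⁺ ∘ inj₂))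
    ... | there E⊆Ks = Any.++⁺ʳ Ls E⊆Ks

  Attached : Subset n → Subset n → Subset n → Set
  Attached Z U K = ∃[ E ] Edge 𝐇 E × E ⊆ˢ Z × Nonempty (E ∩ U) × Nonempty (E ∩ K)

  attached? : ∀ Z U → Decidable (Attached Z U)
  attached? Z U K = anySubset? λ E → edge? 𝐇 E ×-dec (E ⊆? Z) ×-dec nonempty? (E ∩ U) ×-dec nonempty? (E ∩ K)

  -- The component of 𝐇_X ∖ V that contains U is U together with the
  -- components Ks of 𝐇_X ∖ (V ∪ U) that some edge avoiding V joins to U.
  module Split {X V U Ks Ls} (p : Parts (X ─ (V Sub.∪ U)) (Ks ++ Ls))
               (att : All (Attached (X ─ V) U) Ks) (¬att : All (λ L → ¬ Attached (X ─ V) U L) Ls)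
               (U≠∅ : Nonempty U) (U⊆X─V : U ⊆ˢ X ─ V) (U-linked : ∀ {x y} → x ∈ˢ U → y ∈ˢ U → Linked (X ─ V) x y)
               where

    M : Subset n
    M = U Sub.∪ ⋃ Ks

    private
      M⁻ : ∀ {x} → x ∈ˢ M → x ∈ˢ U ⊎ ∃[ K ] K ∈ Ks × x ∈ˢ K
      M⁻ x∈M = Sum.map₂ (find ∘ ∈-⋃⁻ Ks) (x∈p∪q⁻ U (⋃ Ks) x∈M)

      K⊆M : ∀ {K} → K ∈ Ks → K ⊆ˢ M
      K⊆M K∈ x∈K = x∈p∪q⁺ (inj₂ (∈-⋃⁺ (lose K∈ x∈K)))

      piece⊆ : ∀ {K x} → K ∈ Ks ++ Ls → x ∈ˢ K → x ∈ˢ X ─ V × x ∉ˢ U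
      piece⊆ K∈ x∈K =
        let x∈X , x∉ = x∈p─q⁻ X _ (All.lookup (within p) K∈ x∈K) in
        x∈p∧x∉q⇒x∈p─q x∈X (x∉ ∘ x∈p∪q⁺ ∘ inj₁) , x∉ ∘ x∈p∪q⁺ ∘ inj₂

      outside⁺ : ∀ {x} → x ∈ˢ X ─ V → x ∉ˢ U → x ∈ˢ X ─ (V Sub.∪ U)
      outside⁺ x∈ x∉U = let x∈X , x∉V = x∈p─q⁻ X V x∈ in
        x∈p∧x∉q⇒x∈p─q x∈X ([ x∉V , x∉U ]′ ∘ x∈p∪q⁻ V U)

      M⊆ : M ⊆ˢ X ─ V
      M⊆ x∈M with M⁻ x∈M
      ... | inj₁ x∈U            = U⊆X─V x∈U
      ... | inj₂ (K , K∈ , x∈K) = proj₁ (piece⊆ (∈-++⁺ˡ K∈) x∈K)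

      M-disjoint : ∀ {L} → L ∈ Ls → Disjoint M L
      M-disjoint L∈ x x∈M x∈L with M⁻ x∈M
      ... | inj₁ x∈U            = proj₂ (piece⊆ (∈-++⁺ʳ Ks L∈) x∈L) x∈U
      ... | inj₂ (K , K∈ , x∈K) =
        All.lookup (All.lookup (proj₂ (proj₂ (AllPairs-++⁻ Ks (disjoint p)))) K∈) L∈ x x∈K x∈L

      -- A vertex of such an edge outside `U` lies in a component that this very edge attaches to
      -- `U`, hence not in one of `Ls`.
      touching : ∀ {E u} → Edge 𝐇 E → E ⊆ˢ X ─ V → u ∈ˢ E → u ∈ˢ U → E ⊆ˢ M
      touching {E} {u} e E⊆ u∈E u∈U {x} x∈E with x ∈? U
      ... | yes x∈U = x∈p∪q⁺ (inj₁ x∈U)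
      ... | no  x∉U with cover p (outside⁺ (E⊆ x∈E) x∉U)
      ...   | K , K∈ , x∈K with ∈-++⁻ Ks K∈
      ...     | inj₁ K∈Ks = K⊆M K∈Ks x∈K
      ...     | inj₂ K∈Ls = contradiction
        (E , e , (λ {_} → E⊆) , (u , x∈p∩q⁺ (u∈E , u∈U)) , (x , x∈p∩q⁺ (x∈E , x∈K))) (All.lookup ¬att K∈Ls)

      edges′ : ∀ {E} → Edge 𝐇 E → E ⊆ˢ X ─ V → Any (E ⊆ˢ_) (M ∷ Ls)
      edges′ {E} e E⊆ with nonempty? (E ∩ U)
      ... | yes (u , u∈) = let u∈E , u∈U = x∈p∩q⁻ E U u∈ in here (touching e E⊆ u∈E u∈U)
      ... | no  empty with find (edges p e λ x∈E → outside⁺ (E⊆ x∈E) λ x∈U → empty (_ , x∈p∩q⁺ (x∈E , x∈U)))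
      ...   | K , K∈ , E⊆K with ∈-++⁻ Ks K∈
      ...     | inj₁ K∈Ks = here (λ x∈E → K⊆M K∈Ks (E⊆K x∈E))
      ...     | inj₂ K∈Ls = there (lose K∈Ls λ {_} → E⊆K)

      M-closed : Closed (X ─ V) M
      M-closed e E⊆ x∈E y∈E x∈M with edges′ e E⊆
      ... | here E⊆M = E⊆M y∈E
      ... | there E⊆L with find E⊆L
      ...   | L , L∈ , E⊆L = contradiction (E⊆L x∈E) (M-disjoint L∈ _ x∈M)

      to-U : ∀ {x} → x ∈ˢ M → ∃[ u ] u ∈ˢ U × Linked M x u
      to-U {x} x∈M with M⁻ x∈M
      ... | inj₁ x∈U = x , x∈U , λ _ _ z → z
      ... | inj₂ (K , K∈ , x∈K) with All.lookup att K∈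
      ...   | E , e , E⊆ , (u , u∈) , (k , k∈) =
        let u∈E , u∈U = x∈p∩q⁻ E U u∈ ; k∈E , k∈K = x∈p∩q⁻ E K k∈ in
        u , u∈U , Linked-trans (Linked-mono (K⊆M K∈) (All.lookup (linked p) (∈-++⁺ˡ K∈) x∈K k∈K))
                               (Linked-edge e (touching e E⊆ u∈E u∈U) k∈E u∈E)

      -- Every vertex reaches `U` through an attaching edge. Linkage of `U` is given only in
      -- `X ─ V`; as `M` is closed there, it restricts to `M`.
      M-conn : Conn M
      M-conn x∈M y∈M =
        let u , u∈U , xu = to-U x∈M ; v , v∈U , yv = to-U y∈M in
        Linked-trans xu (Linked-trans
          (Linked-restrict M-closed (x∈p∪q⁺ (inj₁ u∈U)) (U-linked u∈U v∈U)) (Linked-sym yv))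

    inner : Parts (M ─ U) Ks
    inner = record
      { nonempties = proj₁ (All.++⁻ Ks (nonempties p))
      ; disjoint   = proj₁ (AllPairs-++⁻ Ks (disjoint p))
      ; within     = All.tabulate λ K∈ x∈K → x∈p∧x∉q⇒x∈p─q (K⊆M K∈ x∈K) (proj₂ (piece⊆ (∈-++⁺ˡ K∈) x∈K))
      ; edges      = edges″
      ; linked     = proj₁ (All.++⁻ Ks (linked p))
      }
      where
      edges″ : ∀ {E} → Edge 𝐇 E → E ⊆ˢ M ─ U → Any (E ⊆ˢ_) Ks
      edges″ {E} e E⊆ with find (edges p e λ x∈E →
                            let x∈M , x∉U = x∈p─q⁻ M U (E⊆ x∈E) in outside⁺ (M⊆ x∈M) x∉U)
      ... | K , K∈ , E⊆K with ∈-++⁻ Ks K∈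
      ...   | inj₁ K∈Ks = lose K∈Ks λ {_} → E⊆K
      ...   | inj₂ K∈Ls with nonempty 𝐇 e
      ...     | x , x∈E = contradiction (E⊆K x∈E) (M-disjoint K∈Ls x (p─q⊆p M U (E⊆ x∈E)))

    outer : Parts (X ─ V) (M ∷ Ls)
    outer = record
      { nonempties = (let u , u∈U = U≠∅ in u , x∈p∪q⁺ (inj₁ u∈U)) ∷ proj₂ (All.++⁻ Ks (nonempties p))
      ; disjoint   = All.tabulate M-disjoint ∷ proj₁ (proj₂ (AllPairs-++⁻ Ks (disjoint p)))
      ; within     = M⊆ ∷ All.tabulate (λ L∈ x∈L → proj₁ (piece⊆ (∈-++⁺ʳ Ks L∈) x∈L))
      ; edges      = edges′
      ; linked     = M-conn ∷ proj₂ (All.++⁻ Ks (linked p))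
      }

    U⊆M : U ⊆ˢ M
    U⊆M x∈U = x∈p∪q⁺ (inj₁ x∈U)

-- Ascent to a construct with a prescribed root.

AllPairs-map-∈ : ∀ {R S : Rel I 0ℓ} {xs} → (∀ {x y} → x ∈ xs → y ∈ xs → R x y → S x y) →
                 AllPairs R xs → AllPairs S xs
AllPairs-map-∈ f []         = []
AllPairs-map-∈ f (rs ∷ rss) =
  All.tabulate (λ y∈ → f (here refl) (there y∈) (All.lookup rs y∈)) ∷
  AllPairs-map-∈ (λ x∈ y∈ → f (there x∈) (there y∈)) rss

module Ascent (𝐎 : OrderedHypergraph n) (rf : OrderedHypergraph.RightFilled 𝐎) where
  open Ordering 𝐎
  open Constructs hypergraph
  open PartsFusion hypergraph
  open Parts

  infix 4 _⋖ᵗ_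
  _⋖ᵗ_ : Rel (Tree n) 0ℓ
  S ⋖ᵗ T = ∃[ U ] ∃[ V ] V <ˢ U × (S ⊂[ U , V ] T ⊎ T ⊂[ V , U ] S)

  -- At `X = ⊤` this unfolds to `_≤ᶠ_`; other vertex sets occur when a child is raised on its own.
  Le : ∀ {X} → Rel (CX X) 0ℓ
  Le = Star λ S T → proj₁ S ≈ proj₁ T ⊎ proj₁ S ⋖ᵗ proj₁ T

  build : ∀ {X Y} cs → Branching X Y cs → CX X
  build cs b = _ , assemble {cs = cs} b

  branching-resp-↭ : ∀ {X Y cs ds} → cs ↭ ds → Branching X Y cs → Branching X Y ds
  branching-resp-↭ σ (ne , Y⊆X , p) = ne , (λ {_} → Y⊆X) , Parts-resp-↭ (↭.map⁺ set σ) p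

  Le-lift : ∀ {X Y K ds} {s t : CX K} (b : Branching X Y ((K , s) ∷ ds)) → Le s t →
            Le (build ((K , s) ∷ ds) b) (build ((K , t) ∷ ds) b)
  Le-lift {K = K} {ds} b = Star.gmap (λ s → build ((K , s) ∷ ds) b)
    (Sum.map (λ s≈t → node (Permutation.prep s≈t (Permutation.refl ≈-refls)))
             (λ (U , V , V<U , st) → U , V , V<U , Sum.map (there ≈-refl ≈-refl) (there ≈-refl ≈-refl) st))

  -- A step of the ascent towards a construct with root B: it may only create
  -- relations that involve B.
  module _ (B : Subset n) where

    Reflects : Tree n → Tree n → Set
    Reflects S T = ∀ {x y} → x ∉ˢ B → y ∉ˢ B → (y <[ T ] x → y <[ S ] x) × (x =[ T ] y → x =[ S ] y)

    infix 4 _⇑_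
    _⇑_ : ∀ {X} → CX X → CX X → Set
    S ⇑ T = Le S T × Reflects (proj₁ S) (proj₁ T)

    ⇑-trans : ∀ {X} {S T R : CX X} → S ⇑ T → T ⇑ R → S ⇑ R
    ⇑-trans (le , rs) (le′ , rs′) = le ◅◅ le′ , λ x∉ y∉ →
      proj₁ (rs x∉ y∉) ∘ proj₁ (rs′ x∉ y∉) , proj₂ (rs x∉ y∉) ∘ proj₂ (rs′ x∉ y∉)

    ⇑-≈ : ∀ {X} {S T : CX X} → proj₁ S ≈ proj₁ T → S ⇑ T
    ⇑-≈ S≈T = inj₁ S≈T ◅ ε , λ _ _ → <ᵗ-resp-≈ (≈-sym S≈T) , =ᵗ-resp-≈ (≈-sym S≈T)

    ⇑-perm : ∀ {X Y cs ds} (σ : cs ↭ ds) (b : Branching X Y cs) → build cs b ⇑ build ds (branching-resp-↭ σ b)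
    ⇑-perm σ b = ⇑-≈ (≈-node (↭.map⁺ tree σ))

    ⇑-lift : ∀ {X Y K ds} {s t : CX K} (b : Branching X Y ((K , s) ∷ ds)) → s ⇑ t →
             build ((K , s) ∷ ds) b ⇑ build ((K , t) ∷ ds) b
    ⇑-lift {Y = Y} {K} {ds} {s} {t} b (le , rs) = Le-lift {ds = ds} b le , λ x∉ y∉ → lt x∉ y∉ , eq x∉ y∉
      where
      lt : ∀ {x y} → x ∉ˢ B → y ∉ˢ B → y <[ node Y (proj₁ t ∷ map tree ds) ] x → y <[ node Y (proj₁ s ∷ map tree ds) ] x
      lt x∉ y∉ y<x with <ᵗ-inv y<x
      ... | inj₁ (x∈Y , here y∈t)  = <ᵗ-here x∈Y (here (support⁺ (proj₂ s) (support⁻ (proj₂ t) y∈t)))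
      ... | inj₁ (x∈Y , there y∈)  = <ᵗ-here x∈Y (there y∈)
      ... | inj₂ (here y<x)        = <ᵗ-there (here (proj₁ (rs x∉ y∉) y<x))
      ... | inj₂ (there y<x)       = <ᵗ-there (there y<x)
      eq : ∀ {x y} → x ∉ˢ B → y ∉ˢ B → x =[ node Y (proj₁ t ∷ map tree ds) ] y → x =[ node Y (proj₁ s ∷ map tree ds) ] y
      eq x∉ y∉ x=y with =ᵗ-inv x=y
      ... | inj₁ (x∈Y , y∈Y)  = =ᵗ-here x∈Y y∈Y
      ... | inj₂ (here x=y)   = =ᵗ-there (here (proj₂ (rs x∉ y∉) x=y))
      ... | inj₂ (there x=y)  = =ᵗ-there (there x=y)

    -- Fusing `C` into the root identifies it with `R` and puts it above the sibling subtrees. All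
    -- these new relations involve `C`, which is part of `B`.
    ⇑-fuse : ∀ {X R C K} us ds (c : Branching K C us) (b : Branching X R ((K , build us c) ∷ ds)) →
             C ⊆ˢ B → C ≪ R → Σ[ b′ ∈ Branching X (R Sub.∪ C) (us ++ ds) ]
               build ((K , build us c) ∷ ds) b ⇑ build (us ++ ds) b′
    ⇑-fuse {X} {R} {C} {K} us ds c@(C≠∅ , C⊆K , q) b@((r , r∈R) , R⊆X , p) C⊆B C≪R =
      ((r , x∈p∪q⁺ (inj₁ r∈R)) , (λ {_} → RC⊆X) , subst (Parts _) (sym (map-++ set us ds)) (Parts-fuse C⊆K p q))
      , inj₂ (R , C , ≪⇒<ˢ C≠∅ (r , r∈R) C≪R , inj₁ (here ≈-refl T≈)) ◅ ε
      , λ x∉ y∉ → lt x∉ y∉ ∘ <ᵗ-resp-≈ T≈ , eq x∉ y∉ ∘ =ᵗ-resp-≈ T≈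
      where
      T≈ : node (R Sub.∪ C) (map tree (us ++ ds)) ≈ node (R Sub.∪ C) (map tree us ++ map tree ds)
      T≈ = ≈-node (↭.↭-reflexive (map-++ tree us ds))
      RC⊆X : R Sub.∪ C ⊆ˢ X
      RC⊆X x∈ = [ R⊆X , p─q⊆p X R ∘ All.head (within p) ∘ C⊆K ]′ (x∈p∪q⁻ R C x∈)
      in-R : ∀ {x} → x ∉ˢ B → x ∈ˢ R Sub.∪ C → x ∈ˢ R
      in-R x∉B x∈ = [ (λ z → z) , (λ x∈C → contradiction (C⊆B x∈C) x∉B) ]′ (x∈p∪q⁻ R C x∈)
      regroup : ∀ {P : Tree n → Set} → (Any P (map tree us) → P (node C (map tree us))) →
                Any P (map tree us ++ map tree ds) → Any P (node C (map tree us) ∷ map tree ds)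
      regroup f any = [ Any.here ∘ f , Any.there ]′ (Any.++⁻ (map tree us) any)
      lt : ∀ {x y} → x ∉ˢ B → y ∉ˢ B → y <[ node (R Sub.∪ C) (map tree us ++ map tree ds) ] x →
           y <[ node R (node C (map tree us) ∷ map tree ds) ] x
      lt x∉ y∉ y<x = [ (λ (x∈ , y∈) → <ᵗ-here (in-R x∉ x∈) (regroup ∈ᵗ-there y∈)) , <ᵗ-there ∘ regroup <ᵗ-there ]′ (<ᵗ-inv y<x)
      eq : ∀ {x y} → x ∉ˢ B → y ∉ˢ B → x =[ node (R Sub.∪ C) (map tree us ++ map tree ds) ] y →
           x =[ node R (node C (map tree us) ∷ map tree ds) ] y
      eq x∉ y∉ x=y = [ (λ (x∈ , y∈) → =ᵗ-here (in-R x∉ x∈) (in-R y∉ y∈)) , =ᵗ-there ∘ regroup =ᵗ-there ]′ (=ᵗ-inv x=y)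

    -- By right-filledness `V ≪ U` keeps `U` linked in `X ─ V`, so that `U` can be the root of a
    -- single child. Every new relation has a vertex of `V`, hence of `B`, on top.
    ⇑-split : ∀ {X V U} ws (b : Branching X (V Sub.∪ U) ws) → Conn X → Nonempty V → Nonempty U → V ⊆ˢ B → V ≪ U →
              ∃[ cs ] Σ[ b′ ∈ Branching X V cs ] build ws b ⇑ build cs b′
    ⇑-split {X} {V} {U} ws b conn V≠∅ U≠∅ V⊆B V≪U
      with separate (attached? (X ─ V) U ∘ set) ws
    ... | ws₁ , ws₂ , σ , att , ¬att with branching-resp-↭ σ b
    ...   | b₁@(_ , VU⊆X , p₁) = (M , child) ∷ ws₂ , bV
      , ⇑-trans (⇑-perm σ b)
        ( inj₂ (U , V , ≪⇒<ˢ V≠∅ U≠∅ V≪U , inj₂ (here ≈-refl S≈)) ◅ ε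
        , λ x∉ y∉ → <ᵗ-resp-≈ (≈-sym S≈) ∘ lt x∉ , =ᵗ-resp-≈ (≈-sym S≈) ∘ eq)
      where
      U⊆X─V : U ⊆ˢ X ─ V
      U⊆X─V u∈U = x∈p∧x∉q⇒x∈p─q (VU⊆X (x∈p∪q⁺ (inj₂ u∈U))) λ u∈V → <-irrefl refl (V≪U u∈V u∈U)
      open Split {X} {V} {U} {map set ws₁} {map set ws₂} (subst (Parts _) (map-++ set ws₁ ws₂) p₁)
        (All.map⁺ att) (All.map⁺ ¬att) U≠∅ (λ {_} → U⊆X─V)
        (λ x∈U y∈U → Linked-remove rf (λ v∈V → V≪U v∈V x∈U , V≪U v∈V y∈U)
          (conn (VU⊆X (x∈p∪q⁺ (inj₂ x∈U))) (VU⊆X (x∈p∪q⁺ (inj₂ y∈U)))))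
      child : CX M
      child = build ws₁ (U≠∅ , (λ {_} → U⊆M) , inner)
      bV : Branching X V ((M , child) ∷ ws₂)
      bV = V≠∅ , (λ {_} v∈V → VU⊆X (x∈p∪q⁺ (inj₁ v∈V))) , outer
      S≈ : node (V Sub.∪ U) (map tree (ws₁ ++ ws₂)) ≈ node (V Sub.∪ U) (map tree ws₁ ++ map tree ws₂)
      S≈ = ≈-node (↭.↭-reflexive (map-++ tree ws₁ ws₂))
      lt : ∀ {x y} → x ∉ˢ B → y <[ node V (node U (map tree ws₁) ∷ map tree ws₂) ] x →
           y <[ node (V Sub.∪ U) (map tree ws₁ ++ map tree ws₂) ] x
      lt x∉ y<x with <ᵗ-inv y<x
      ... | inj₁ (x∈V , _)   = contradiction (V⊆B x∈V) x∉
      ... | inj₂ (there y<x) = <ᵗ-there (Any.++⁺ʳ (map tree ws₁) y<x)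
      ... | inj₂ (here y<x)  = [ (λ (x∈U , y∈) → <ᵗ-here (x∈p∪q⁺ (inj₂ x∈U)) (Any.++⁺ˡ y∈)) , <ᵗ-there ∘ Any.++⁺ˡ ]′ (<ᵗ-inv y<x)
      eq : ∀ {x y} → x =[ node V (node U (map tree ws₁) ∷ map tree ws₂) ] y →
           x =[ node (V Sub.∪ U) (map tree ws₁ ++ map tree ws₂) ] y
      eq x=y with =ᵗ-inv x=y
      ... | inj₁ (x∈V , y∈V) = =ᵗ-here (x∈p∪q⁺ (inj₁ x∈V)) (x∈p∪q⁺ (inj₁ y∈V))
      ... | inj₂ (there x=y) = =ᵗ-there (Any.++⁺ʳ (map tree ws₁) x=y)
      ... | inj₂ (here x=y)  = [ (λ (x∈U , y∈U) → =ᵗ-here (x∈p∪q⁺ (inj₂ x∈U)) (x∈p∪q⁺ (inj₂ y∈U)))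
                               , =ᵗ-there ∘ Any.++⁺ˡ ]′ (=ᵗ-inv x=y)

    Avoids : Child → Set
    Avoids c = ∀ {x} → x ∈ˢ set c → x ∉ˢ B

    Extracted : Child → Set
    Extracted (K , s) = ∃[ us ] Σ[ b ∈ Branching K (B ∩ K) us ] s ⇑ build us b

    -- Fusing C = B ∩ K makes C an ancestor of the other children, so that the
    -- pieces of the latter must be smaller than C too: hence the sorting.
    fuse-all : ∀ {X R} todo done (b : Branching X R (todo ++ done)) →
               AllPairs (λ c d → set d ≪ set c) todo → All (λ c → (B ∩ set c) ≪ R) todo →
               All (λ c → Avoids c ⊎ Extracted c) todo → All Avoids done →
               ∃[ R′ ] ∃[ ws ] Σ[ b′ ∈ Branching X R′ ws ] R ⊆ˢ R′ × R′ ⊆ˢ R Sub.∪ B × All Avoids ws ×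
                 build (todo ++ done) b ⇑ build ws b′
    fuse-all {R = R} [] done b [] [] [] av =
      R , done , b , (λ {_} z → z) , p⊆p∪q B , av , ⇑-≈ ≈-refl
    fuse-all {X} {R} (c ∷ todo) done b (_ ∷ sorted) (_ ∷ ≪R) (inj₁ c-av ∷ ready) av
      with fuse-all todo (c ∷ done) (branching-resp-↭ (↭.↭-sym (↭.shift c todo done)) b) sorted ≪R ready
             ((λ {_} → c-av) ∷ av)
    ... | R′ , ws , b′ , R⊆ , ⊆R , ws-av , up =
      R′ , ws , b′ , (λ {_} → R⊆) , (λ {_} → ⊆R) , ws-av , ⇑-trans (⇑-perm (↭.↭-sym (↭.shift c todo done)) b) up
    fuse-all {X} {R} ((K , s) ∷ todo) done b (K≫ ∷ sorted) (K≪R ∷ ≪R) (inj₂ (us , bK , s⇑) ∷ ready) av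
      with ⇑-fuse us (todo ++ done) bK b (p∩q⊆p B K) K≪R
    ... | b₁ , up₁
      with fuse-all todo (us ++ done) (branching-resp-↭ (↭.shifts us todo) b₁) sorted ≪R₁ ready (All.++⁺ us-av av)
      where
      ≪R₁ : All (λ c → (B ∩ set c) ≪ (R Sub.∪ (B ∩ K))) todo
      ≪R₁ = All.tabulate λ {c} c∈ x∈ r∈ →
        [ All.lookup ≪R c∈ x∈ , All.lookup K≫ c∈ (p∩q⊆q B (set c) x∈) ∘ p∩q⊆q B K ]′ (x∈p∪q⁻ R _ r∈)
      us-av : All Avoids us
      us-av = All.tabulate λ c∈ x∈c x∈B →
        let x∈K , x∉BK = Root.child⊆ {cs = us} bK c∈ x∈c in x∉BK (x∈p∩q⁺ (x∈B , x∈K))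
    ...   | R′ , ws , b′ , R⊆ , ⊆R , ws-av , up₂ =
      R′ , ws , b′ , (λ {_} → R⊆ ∘ x∈p∪q⁺ ∘ inj₁)
      , (λ {_} x∈R′ → [ (λ x∈ → x∈p∪q⁺ (Sum.map₂ (p∩q⊆p B K) (x∈p∪q⁻ R _ x∈))) , x∈p∪q⁺ ∘ inj₂ ]′ (x∈p∪q⁻ _ B (⊆R x∈R′)))
      , ws-av
      , ⇑-trans (⇑-lift {ds = todo ++ done} b s⇑) (⇑-trans up₁ (⇑-trans (⇑-perm (↭.shifts us todo) b₁) up₂))

    -- All that the ascent uses of the assumption on `S`: it mentions only the root `B` of the
    -- target and passes to subtrees.
    Compatible : Tree n → Set
    Compatible S = ∀ {x y} → y ∈ˢ B → x < y → ¬ y <[ S ] x × (x ∉ˢ B → ¬ x =[ S ] y)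

  private
    -- Disjoint components are comparable as whole sets, so any representative is good enough for
    -- sorting them.
    root-vertex : Child → Fin n
    root-vertex c = proj₁ (root-nonempty (proj₂ (proj₂ c)))

    ≤-decTotalOrder : DecTotalOrder 0ℓ 0ℓ 0ℓ
    ≤-decTotalOrder = record { isDecTotalOrder = record
      { isTotalOrder = isTotalOrder ; _≟_ = Fin._≟_ ; _≤?_ = _≤?_ } }
      where
      _≤?_ : ∀ x y → Dec (x ≤ y)
      x ≤? y with y <? x
      ... | no  y≮x = yes (≮⇒≥ y≮x)
      ... | yes (y≤x , y≢x) = no λ x≤y → y≢x (antisym y≤x x≤y)

    descending : DecTotalOrder 0ℓ 0ℓ 0ℓ
    descending = On.decTotalOrder (Flip.decTotalOrder ≤-decTotalOrder) root-vertex

  open Sort descending using (sort; sort-↭; sort-↗)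

  -- The sorting compares representatives weakly; disjointness makes the comparison strict, and
  -- `components-≪` extends it to the whole sets.
  sort-≫ : ∀ {Z} cs → Parts Z (map set cs) → AllPairs (λ c d → set d ≪ set c) (sort cs)
  sort-≫ {Z} cs p = AllPairs-map-∈ compare-children
    (AllPairs.zip (Linked⇒AllPairs (flip ≤-trans) (sort-↗ cs) , AllPairs.map⁻ (disjoint p′)))
    where
    p′ : Parts Z (map set (sort cs))
    p′ = Parts-resp-↭ (↭.map⁺ set (↭.↭-sym (sort-↭ cs))) p
    compare-children : ∀ {c d} → c ∈ sort cs → d ∈ sort cs →
                       root-vertex d ≤ root-vertex c × Disjoint (set c) (set d) → set d ≪ set c
    compare-children {c} {d} c∈ d∈ (d≤c , disj) =
      components-≪ rf (closed p′ d∈′) (closed p′ c∈′) (All.lookup (within p′) d∈′) (All.lookup (within p′) c∈′)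
        (All.lookup (linked p′) d∈′) (All.lookup (linked p′) c∈′) (λ x∈d x∈c → disj _ x∈c x∈d) d₀∈ c₀∈
        (d≤c , λ d≡c → disj _ (subst (_∈ˢ set c) (sym d≡c) c₀∈) d₀∈)
      where
      c∈′ = ∈-map⁺ set c∈
      d∈′ = ∈-map⁺ set d∈
      c₀∈ = proj₂ (root-nonempty (proj₂ (proj₂ c)))
      d₀∈ = proj₂ (root-nonempty (proj₂ (proj₂ d)))

  -- The induction sees only the vertex set and the tree, so the claim is made for every proof `c`
  -- that this tree is a construct.
  extract : ∀ B {X S} → IsConstruct hypergraph X S → (c : IsConstruct hypergraph X S) → Conn X →
            Compatible B S → Nonempty (B ∩ X) → Extracted B (X , S , c)
  extract B = construct-induction
    (λ X S → (c : IsConstruct hypergraph X S) → Conn X → Compatible B S → Nonempty (B ∩ X) → Extracted B (X , S , c))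
    step
    where
    step : ∀ {X Y} cs → Branching X Y cs →
      All (λ d → (c : IsConstruct hypergraph (set d) (tree d)) → Conn (set d) → Compatible B (tree d) →
                 Nonempty (B ∩ set d) → Extracted B (set d , tree d , c)) cs →
      (c : IsConstruct hypergraph X (node Y (map tree cs))) → Conn X → Compatible B (node Y (map tree cs)) →
      Nonempty (B ∩ X) → Extracted B (X , node Y (map tree cs) , c)
    step {X} {Y} cs b ih c conn compat B∩X≠∅ = finish
      where
      open Root {cs = cs} b
      σ : cs ↭ sort cs
      σ = ↭.↭-sym (sort-↭ cs)
      -- A vertex of `B` in a child lies below every vertex of the root, and `Compatible` forbids
      -- that one of these is smaller.
      B≪Y : ∀ {d} → d ∈ cs → (B ∩ set d) ≪ Y
      B≪Y {d} d∈ {x} {y} x∈ y∈Y with x∈p∩q⁻ B (set d) x∈ | compare x y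
      ... | x∈B , x∈d | tri< x<y _ _ = x<y
      ... | x∈B , x∈d | tri≈ _ refl _ = contradiction y∈Y (proj₂ (child⊆ d∈ x∈d))
      ... | x∈B , x∈d | tri> _ _ y<x =
        let x∈X , x∉Y = child⊆ d∈ x∈d in
        contradiction (below-root y∈Y x∈X x∉Y) (proj₁ (compat x∈B y<x))
      ready : ∀ {d} → d ∈ cs → Avoids B d ⊎ Extracted B d
      ready {d} d∈ with nonempty? (B ∩ set d)
      ... | no empty = inj₁ λ x∈d x∈B → empty (_ , x∈p∩q⁺ (x∈B , x∈d))
      ... | yes B∩d≠∅ = inj₂ (All.lookup ih d∈ (proj₂ (proj₂ d)) (child-conn d∈) compat′ B∩d≠∅)
        where
        compat′ : Compatible B (tree d)
        compat′ y∈B x<y = proj₁ (compat y∈B x<y) ∘ <ᵗ-there ∘ any-child⁺ d∈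
                        , λ x∉B → proj₂ (compat y∈B x<y) x∉B ∘ =ᵗ-there ∘ any-child⁺ d∈
      σ′ : cs ↭ sort cs ++ []
      σ′ = ↭.trans σ (↭.↭-sym (↭.++-identityʳ (sort cs)))
      conclude : ∀ {R ws} (b′ : Branching X R ws) → Y ⊆ˢ R → R ⊆ˢ Y Sub.∪ B → All (Avoids B) ws →
                 _⇑_ B (_ , c) (build ws b′) → Extracted B (X , _ , c)
      conclude {R} {ws} b′ Y⊆R R⊆YB av up with nonempty? (R ─ B)
      -- The fused root has no vertex outside `B`: it already is `B ∩ X`, and there is nothing to
      -- split off.
      ... | no empty = absorb R≡
        where
        R⊆ : R ⊆ˢ B ∩ X
        R⊆ {x} x∈R with x ∈? B
        ... | yes x∈B = x∈p∩q⁺ (x∈B , proj₁ (proj₂ b′) x∈R)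
        ... | no  x∉B = contradiction (x , x∈p∧x∉q⇒x∈p─q x∈R x∉B) empty
        -- The children avoid `B`, so all of `B` inside `X` has been gathered in the root.
        ⊆R : B ∩ X ⊆ˢ R
        ⊆R {x} x∈ with x∈p∩q⁻ B X x∈ | x ∈? R
        ... | _         | yes x∈R = x∈R
        ... | x∈B , x∈X | no  x∉R with Root.cover-child {cs = ws} b′ x∈X x∉R
        ...   | d , d∈ , x∈d = contradiction x∈B (All.lookup av d∈ x∈d)
        R≡ : R ≡ B ∩ X
        R≡ = ⊆-antisym R⊆ ⊆R
        absorb : R ≡ B ∩ X → Extracted B (X , _ , c)
        absorb refl = ws , b′ , up
      ... | yes U≠∅ = absorb R≡
        where
        ⊆R : (B ∩ X) Sub.∪ (R ─ B) ⊆ˢ R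
        ⊆R {x} x∈ with x ∈? R | x∈p∪q⁻ (B ∩ X) _ x∈
        ... | yes x∈R | _        = x∈R
        ... | no  x∉R | inj₂ x∈U = p─q⊆p R B x∈U
        ... | no  x∉R | inj₁ x∈BX with x∈p∩q⁻ B X x∈BX
        ...   | x∈B , x∈X with Root.cover-child {cs = ws} b′ x∈X x∉R
        ...     | d , d∈ , x∈d = contradiction x∈B (All.lookup av d∈ x∈d)
        R⊆ : R ⊆ˢ (B ∩ X) Sub.∪ (R ─ B)
        R⊆ {x} x∈R with x ∈? B
        ... | yes x∈B = x∈p∪q⁺ (inj₁ (x∈p∩q⁺ (x∈B , proj₁ (proj₂ b′) x∈R)))
        ... | no  x∉B = x∈p∪q⁺ (inj₂ (x∈p∧x∉q⇒x∈p─q x∈R x∉B))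
        R≡ : R ≡ (B ∩ X) Sub.∪ (R ─ B)
        R≡ = ⊆-antisym R⊆ ⊆R
        -- A vertex `u` of `R` outside `B` stems from the original root `Y`. If it were smaller than
        -- `v` in `B`, it would be above `v` or in its node in the original tree, against
        -- `Compatible`.
        V≪U : (B ∩ X) ≪ (R ─ B)
        V≪U {v} {u} v∈ u∈ with x∈p∩q⁻ B X v∈ | x∈p─q⁻ R B u∈ | compare v u
        ... | _         | _         | tri< v<u _ _    = v<u
        ... | v∈B , _   | _   , u∉B | tri≈ _ refl _ = contradiction v∈B u∉B
        ... | v∈B , v∈X | u∈R , u∉B | tri> _ _ u<v with v ∈? Y | x∈p∪q⁻ Y B (R⊆YB u∈R)
        ...   | _       | inj₂ u∈B = contradiction u∈B u∉B
        ...   | yes v∈Y | inj₁ u∈Y = contradiction (=ᵗ-here u∈Y v∈Y) (proj₂ (compat v∈B u<v) u∉B)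
        ...   | no  v∉Y | inj₁ u∈Y = contradiction (below-root u∈Y v∈X v∉Y) (proj₁ (compat v∈B u<v))
        absorb : R ≡ (B ∩ X) Sub.∪ (R ─ B) → Extracted B (X , _ , c)
        absorb eq with ⇑-split B ws (subst (λ R → Branching X R ws) eq b′) conn B∩X≠∅ U≠∅ (p∩q⊆p B X) V≪U
        ... | ds , b″ , up′ = ds , b″ , ⇑-trans B up (⇑-trans B (⇑-≈ B (same-tree eq)) up′)
          where
          same-tree : ∀ {R′} → R ≡ R′ → node R (map tree ws) ≈ node R′ (map tree ws)
          same-tree refl = ≈-refl
      finish : Extracted B (X , node Y (map tree cs) , c)
      finish with fuse-all B (sort cs) [] (branching-resp-↭ σ′ b) (sort-≫ cs (proj₂ (proj₂ b)))
                    (↭.All-resp-↭ σ (All.tabulate B≪Y)) (↭.All-resp-↭ σ (All.tabulate ready)) []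
      ... | R , ws , b′ , Y⊆R , R⊆YB , av , up =
        conclude b′ Y⊆R R⊆YB av (⇑-trans B (⇑-≈ B (≈-node (↭.map⁺ tree σ′))) up)

-- The two implications for arbitrary connected vertex sets.

module Characterisation (𝐎 : OrderedHypergraph n) (rf : OrderedHypergraph.RightFilled 𝐎) where
  open Ordering 𝐎
  open Constructs hypergraph
  open Soundness 𝐎 rf
  open Ascent 𝐎 rf

  Le⇒⊑ : ∀ {X} {S T : CX X} → Conn X → Le S T → proj₁ S ⊑ proj₁ T
  Le⇒⊑ conn ε = ≈⇒⊑ ≈-refl
  Le⇒⊑ conn (inj₁ S≈R ◅ le) = ⊑-trans (≈⇒⊑ S≈R) (Le⇒⊑ conn le)
  Le⇒⊑ conn (inj₂ (U , V , V<U , inj₁ S⊂R) ◅ le) =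
    ⊑-trans (fusion⇒⊑ (<ˢ⇒≪ V<U) S⊂R) (Le⇒⊑ conn le)
  -- In a split the contracted edge belongs to the later construct `R`, so it is the proof for `R`
  -- that is passed on.
  Le⇒⊑ conn (_◅_ {j = R} (inj₂ (U , V , V<U , inj₂ R⊂S)) le) =
    ⊑-trans (split⇒⊑ conn (proj₂ R) (<ˢ⇒≪ V<U) R⊂S) (Le⇒⊑ conn le)

  data Below : Child → Child → Set where
    below : ∀ {K} {s t : CX K} → Le s t → Below (K , s) (K , t)

  -- Only the first child can be raised by `Le-lift`. Once raised, it is moved to `done`, and it is
  -- moved back after the others have been treated.
  lift-all : ∀ {X Y us ts} done (b : Branching X Y (us ++ done)) → Pointwise Below us ts →
             Σ[ b′ ∈ Branching X Y (ts ++ done) ] Le (build (us ++ done) b) (build (ts ++ done) b′)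
  lift-all done b [] = b , ε
  lift-all {us = u ∷ us} {t ∷ ts} done b (below le ∷ les)
    with lift-all (t ∷ done) (branching-resp-↭ (↭.↭-sym (↭.shift t us done)) b) les
  ... | b′ , le′ = branching-resp-↭ (↭.shift t ts done) b′
    , Le-lift {ds = us ++ done} b le
      ◅◅ inj₁ (≈-node (↭.map⁺ tree (↭.↭-sym (↭.shift t us done))))
      ◅ le′ ◅◅ inj₁ (≈-node (↭.map⁺ tree (↭.shift t ts done))) ◅ ε

  match-children : ∀ us ts → map set us ≡ map set ts →
                   (∀ {K s t} → (K , s) ∈ us → (K , t) ∈ ts → Le s t) → Pointwise Below us ts
  match-children []             []             _  f = []
  match-children ((K , s) ∷ us) ((L , t) ∷ ts) eq f with ∷-injective eq
  ... | refl , eq = below (f (here refl) (here refl)) ∷ match-children us ts eq λ s∈ t∈ → f (there s∈) (there t∈)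

  -- Induction on the target: once its root has been brought to the top of `S`, only the children
  -- remain to be compared. As in `extract`, the claim covers every proof `c` for the target tree.
  ⊑⇒Le : ∀ {X T} → IsConstruct hypergraph X T → (c : IsConstruct hypergraph X T) → Conn X →
         (S : CX X) → proj₁ S ⊑ T → Le S (T , c)
  ⊑⇒Le = construct-induction
    (λ X T → (c : IsConstruct hypergraph X T) → Conn X → (S : CX X) → proj₁ S ⊑ T → Le S (T , c)) step
    where
    step : ∀ {X B} ts → Branching X B ts →
      All (λ t → (c : IsConstruct hypergraph (set t) (tree t)) → Conn (set t) →
                 (S : CX (set t)) → proj₁ S ⊑ tree t → Le S (tree t , c)) ts →
      (c : IsConstruct hypergraph X (node B (map tree ts))) → Conn X →
      (S : CX X) → proj₁ S ⊑ node B (map tree ts) → Le S (node B (map tree ts) , c)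
    step {X} {B} ts bT@((x , x∈B) , B⊆X , pT) ih c conn (S , cS) (inv , inv~)
      with extract B cS cS conn compat (x , x∈p∩q⁺ (x∈B , B⊆X x∈B))
      where
      open Root {cs = ts} bT
      -- In the target `y` lies in the root, so nothing is above it and only vertices of `B` share
      -- its node; the assumption carries this back to `S`.
      compat : Compatible B S
      compat {x} {y} y∈B x<y = root-top y∈B ∘ inv x<y , λ x∉B x=y →
        [ (λ x=y → x∉B (proj₂ (root-= x=y) y∈B)) , root-top y∈B ]′ (inv~ x<y x=y)
    ... | us , b , S⇑ = conclude B∩X≡B b S⇑
      where
      target : Tree n
      target = node B (map tree ts)
      B∩X≡B : B ∩ X ≡ B
      B∩X≡B = ⊆-antisym (p∩q⊆p B X) λ y∈B → x∈p∩q⁺ (y∈B , B⊆X y∈B)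
      conclude : ∀ {B′} → B′ ≡ B → (b : Branching X B′ us) → _⇑_ B (S , cS) (build us b) → Le (S , cS) (target , c)
      -- The components of `X ─ B` are unique up to order, so the new children can be listed with
      -- the same vertex sets as those of the target.
      conclude refl b S⇑ with ↭.↭-map-inv set (Parts-unique (proj₂ (proj₂ b)) pT)
      ... | vs , eq , σ = proj₁ S⇑V ◅◅ Le-VT
        where
        bV : Branching X B vs
        bV = branching-resp-↭ σ b
        S⇑V : _⇑_ B (S , cS) (build vs bV)
        S⇑V = ⇑-trans B S⇑ (⇑-perm B σ b)
        module V = Root {cs = vs} bV
        module T = Root {cs = ts} bT
        -- Pairs outside `B` were already related in `S`, where the assumption applies; pairs
        -- meeting `B` are settled by `B` being the root of both trees.
        V⊑T : node B (map tree vs) ⊑ target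
        V⊑T = lt , eq′
          where
          lt : ∀ {x y} → x < y → y <[ node B (map tree vs) ] x → y <[ target ] x
          lt {x} {y} x<y y<x with x ∈? B | y ∈? B
          ... | _       | yes y∈B = contradiction y<x (V.root-top y∈B)
          ... | yes x∈B | no  y∉B = T.below-root x∈B (support⁻ (proj₂ (build vs bV)) (proj₁ (<ᵗ⇒∈ᵗ y<x))) y∉B
          ... | no  x∉B | no  y∉B = inv x<y (proj₁ (proj₂ S⇑V x∉B y∉B) y<x)
          eq′ : ∀ {x y} → x < y → x =[ node B (map tree vs) ] y → x =[ target ] y ⊎ y <[ target ] x
          eq′ {x} {y} x<y x=y with x ∈? B | y ∈? B
          ... | yes x∈B | yes y∈B = inj₁ (=ᵗ-here x∈B y∈B)
          ... | yes x∈B | no  y∉B = contradiction (proj₁ (V.root-= x=y) x∈B) y∉B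
          ... | no  x∉B | yes y∈B = contradiction (proj₂ (V.root-= x=y) y∈B) x∉B
          ... | no  x∉B | no  y∉B = inv~ x<y (proj₂ (proj₂ S⇑V x∉B y∉B) x=y)
        children-Le : ∀ {K s t} → (K , s) ∈ vs → (K , t) ∈ ts → Le s t
        children-Le {K} {s} {t} s∈ t∈ = All.lookup ih t∈ (proj₂ t) (T.child-conn t∈) s (lt , eq′)
          where
          lt : ∀ {x y} → x < y → y <[ proj₁ s ] x → y <[ proj₁ t ] x
          lt x<y y<x = T.in-child-< t∈ (support⁻ (proj₂ s) (proj₂ (<ᵗ⇒∈ᵗ y<x)))
                         (proj₁ V⊑T x<y (<ᵗ-there (any-child⁺ s∈ y<x)))
          eq′ : ∀ {x y} → x < y → x =[ proj₁ s ] y → x =[ proj₁ t ] y ⊎ y <[ proj₁ t ] x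
          eq′ x<y x=y = Sum.map (T.in-child-= t∈ x∈K) (T.in-child-< t∈ x∈K) (proj₂ V⊑T x<y (=ᵗ-there (any-child⁺ s∈ x=y)))
            where x∈K = support⁻ (proj₂ s) (proj₁ (=ᵗ⇒∈ᵗ x=y))
        Le-VT : Le (build vs bV) (target , c)
        Le-VT with lift-all [] (branching-resp-↭ (↭.↭-sym (↭.++-identityʳ vs)) bV)
                     (match-children vs ts (sym eq) children-Le)
        ... | _ , le = inj₁ (≈-node (↭.map⁺ tree (↭.↭-sym (↭.++-identityʳ vs)))) ◅
                       le ◅◅ inj₁ (≈-node (↭.map⁺ tree (↭.++-identityʳ ts))) ◅ ε

theorem2p44 : (n : ℕ) (𝐇 : OrderedHypergraph n) →
    let open OrderedHypergraph 𝐇 in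
    Connected hypergraph ⊤ → RightFilled →
    (S T : Construct hypergraph) →
    S ≤ᶠ T ⇔ (Inv S ⊆ Inv T × Inv~ S ⊆ Inv~ T ∪ Inv T)
theorem2p44 n 𝐇 connected rf S T = mk⇔ to from
  where
  open Ordering 𝐇
  open Constructs hypergraph
  open Soundness 𝐇 rf
  open Characterisation 𝐇 rf
  conn : Conn ⊤
  conn = Connected⇒Conn connected
  to : S ≤ᶠ T → Inv S ⊆ Inv T × Inv~ S ⊆ Inv~ T ∪ Inv T
  to S≤T = let inv , inv~ = Le⇒⊑ conn S≤T in
    (λ {_} (a<b , b<a) → a<b , inv a<b b<a)
    , (λ {_} (a<b , a=b) → Sum.map (a<b ,_) (a<b ,_) (inv~ a<b a=b))
  from : Inv S ⊆ Inv T × Inv~ S ⊆ Inv~ T ∪ Inv T → S ≤ᶠ T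
  from (inv , inv~) = ⊑⇒Le (proj₂ T) (proj₂ T) conn S
    ( (λ a<b b<a → proj₂ (inv (a<b , b<a)))
    , (λ a<b a=b → Sum.map proj₂ proj₂ (inv~ (a<b , a=b))))
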